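{- Let $\mathcal S=(\mathcal P,\mathcal L)$ be a finite thick generalized quadrangle of order $(s,t)$ admitting an automorphism group $G$ acting regularly on $\mathcal P$, with $\mathcal P$ identified with $G$ as in the context. Let $\theta\in\mathrm{Aut}(G)$ be a multiplier and $H=C_G(\theta)$. Then either $H=1$, or $|H|>1$ and the fixed substructure $\mathcal S_\theta=(\mathcal P_0(\theta),\mathcal L_0(\theta))$ satisfies one of the following: (a) $\mathcal S_\theta$ is a partial ovoid, and $|H|\le 1+st$; (b) all points of $H$ are incident with a common line, and $|H|$ divides $1+s$; (c) $\mathcal S_\theta$ is a grid with parameters $(s_1,s_2)$, and there are subgroups $Y_1,Y_2$ of $H$ with $H=Y_1Y_2$, $|Y_i|=s_i+1$, $s_i+1\mid s+1$, and the points of $Y_i$ are incident with a common line, for $i=1,2$; (c') $\mathcal S_\theta$ is a thin subquadrangle of order $(s_1,1)$ with $s_1\le\min\{s,t\}$, and $H=\langle X_1,g_1\rangle$ for a subgroup $X_1$ of order $\frac{s_1+1}{2}$ and an element $g_1\in H$, such that the sets of points of $H$ on the two fixed lines incident with $1$ are $X_1\cup g_1X_1$ and $g_1X_1g_1^{ -1}\cup X_1g_1^{ -1}$ respectively; (d) $\mathcal S_\theta$ is a thin subquadrangle of order $(1,t_1)$ with $2\le t_1\le\min\{s,t\}$, and $H$ has a subgroup of index $2$ consisting of pairwise noncollinear points; (e) $\mathcal S_\theta$ is a subquadrangle of order $(s',t')$ with $\min\{s',t'\}\ge 2$.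
   Context: A finite generalized quadrangle of order $(s,t)$ is a point-line incidence structure whose incidence graph is bipartite of diameter $4$ and girth $8$, with $s+1$ points per line and $t+1$ lines per point; thick means $s,t\ge2$. Fix a point $p$ and identify $\mathcal P$ with $G$ via $p^g\mapsto g$; $G$ acts by right multiplication. An automorphism $\theta$ of the group $G$ is a multiplier if $g\mapsto g^\theta$ induces an automorphism of $\mathcal S$; $C_G(\theta)$ is its fixed-point subgroup. $\mathcal P_0(\theta)$, $\mathcal L_0(\theta)$ are the sets of fixed points and fixed lines, and $\mathcal S_\theta$ is the incidence substructure they induce. $\mathcal S_\theta$ is a partial ovoid if $\mathcal L_0(\theta)=\varnothing$ and the points of $\mathcal P_0(\theta)$ are pairwise noncollinear. A grid with parameters $(s_1,s_2)$ has points $x_{i,j}$ ($0\le i\le s_1$, $0\le j\le s_2$) and lines $\ell_0,\dots,\ell_{s_1},\ell'_0,\dots,\ell'_{s_2}$ with $x_{i,j}$ on $\ell_k$ iff $i=k$ and on $\ell'_k$ iff $j=k$; a dual grid with parameters $(t_1,t_2)$ is the point-line dual of a grid with parameters $(t_2,t_1)$. A thin subquadrangle of order $(s_1,1)$ is a grid with parameters $(s_1,s_1)$; one of order $(1,t_1)$ is a dual grid with parameters $(t_1,t_1)$. A subquadrangle of order $(s',t')$ is a substructure that is itself a generalized quadrangle of that order. -}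

module Defs where

open import Level using (0ℓ)
open import Data.Bool using (Bool; true; false)
open import Data.Nat using (ℕ; zero; suc; _+_; _*_; _≤_; _<_; _⊓_)
open import Data.Nat.Divisibility using (_∣_)
open import Data.Fin using (Fin; zero; suc; inject₁; fromℕ; _≟_)
open import Data.Sum using (_⊎_; inj₁; inj₂)
open import Data.Product using (Σ; ∃; ∃-syntax; _×_; _,_; proj₁)
open import Data.Empty using (⊥)
open import Relation.Nullary using (¬_; does)
open import Relation.Binary.PropositionalEquality using (_≡_; _≢_)
open import Function.Bundles using (_↔_; _⇔_; Inverse)
open import Function.Definitions using (Bijective; Injective)
open import Algebra.Bundles.Raw using (RawGroup)
open import Algebra.Morphism.Structures using (module GroupMorphisms)

HasSize : Set → ℕ → Set
HasSize A n = A ↔ Fin n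

record IncStr : Set₁ where
  constructor mkInc
  field
    Pt  : Set
    Ln  : Set
    inc : Pt → Ln → Bool

_≅_ : IncStr → IncStr → Set
S ≅ T = Σ (IncStr.Pt S ↔ IncStr.Pt T) λ α → Σ (IncStr.Ln S ↔ IncStr.Ln T) λ β →
  ∀ x l → IncStr.inc S x l ≡ IncStr.inc T (Inverse.to α x) (Inverse.to β l)

Grid : ℕ → ℕ → IncStr
Grid s₁ s₂ = mkInc (Fin (suc s₁) × Fin (suc s₂)) (Fin (suc s₁) ⊎ Fin (suc s₂)) gi
  where
  gi : Fin (suc s₁) × Fin (suc s₂) → Fin (suc s₁) ⊎ Fin (suc s₂) → Bool
  gi (i , j) (inj₁ k) = does (i ≟ k)
  gi (i , j) (inj₂ k) = does (j ≟ k)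

Dual : IncStr → IncStr
Dual S = mkInc (IncStr.Ln S) (IncStr.Pt S) (λ l x → IncStr.inc S x l)

DualGrid : ℕ → ℕ → IncStr
DualGrid t₁ t₂ = Dual (Grid t₂ t₁)

IsAut : {P L : Set} → (P → L → Bool) → (P → P) → (L → L) → Set
IsAut inc f φ = Bijective _≡_ _≡_ f × Bijective _≡_ _≡_ φ × (∀ x l → inc x l ≡ inc (f x) (φ l))

module IncidenceGraph (S : IncStr) where
  open IncStr S

  Vtx : Set
  Vtx = Pt ⊎ Ln

  Adj : Vtx → Vtx → Set
  Adj (inj₁ x) (inj₂ l) = inc x l ≡ true
  Adj (inj₂ l) (inj₁ x) = inc x l ≡ true
  Adj (inj₁ _) (inj₁ _) = ⊥
  Adj (inj₂ _) (inj₂ _) = ⊥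

  data Walk : Vtx → Vtx → ℕ → Set where
    here : ∀ {u} → Walk u u 0
    step : ∀ {u v w n} → Adj u v → Walk v w n → Walk u w (suc n)

  Cycle : ℕ → Set
  Cycle zero    = ⊥
  Cycle (suc m) = 3 ≤ suc m × Σ (Fin (suc m) → Vtx) λ c →
    Injective _≡_ _≡_ c × (∀ (i : Fin m) → Adj (c (inject₁ i)) (c (suc i))) × Adj (c (fromℕ m)) (c zero)

  Diameter4 : Set
  Diameter4 = (∀ u v → ∃[ k ] (k ≤ 4 × Walk u v k))
            × (∃[ u ] ∃[ v ] ∀ k → Walk u v k → 4 ≤ k)

  Girth8 : Set
  Girth8 = Cycle 8 × (∀ k → Cycle k → 8 ≤ k)

IsGQ : IncStr → ℕ → ℕ → Set
IsGQ S s t = Diameter4 × Girth8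
           × (∀ l → HasSize (Σ Pt λ x → inc x l ≡ true) (suc s))
           × (∀ x → HasSize (Σ Ln λ l → inc x l ≡ true) (suc t))
  where open IncStr S
        open IncidenceGraph S

rawGroup : (G : Set) → (G → G → G) → G → (G → G) → RawGroup 0ℓ 0ℓ
rawGroup G _∙_ ε _⁻¹ = record { Carrier = G ; _≈_ = _≡_ ; _∙_ = _∙_ ; ε = ε ; _⁻¹ = _⁻¹ }

IsGroupAutomorphism : (G : Set) → (G → G → G) → G → (G → G) → (G → G) → Set
IsGroupAutomorphism G _∙_ ε _⁻¹ θ =
  GroupMorphisms.IsGroupIsomorphism (rawGroup G _∙_ ε _⁻¹) (rawGroup G _∙_ ε _⁻¹) θ

-- Points = G, lines L, incidence inc; θ a multiplier with induced line map φ.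
module Setting (G : Set) (_∙_ : G → G → G) (ε : G) (_⁻¹ : G → G)
               (L : Set) (inc : G → L → Bool) (s t : ℕ)
               (θ : G → G) (φ : L → L) where

  InH : G → Set
  InH g = θ g ≡ g

  H : Set
  H = Σ G InH

  L₀ : Set
  L₀ = Σ L λ l → φ l ≡ l

  Sθ : IncStr
  Sθ = mkInc H L₀ (λ x l → inc (proj₁ x) (proj₁ l))

  Collinear : G → G → Set
  Collinear x y = ∃[ l ] (inc x l ≡ true × inc y l ≡ true)

  PartialOvoid : Set
  PartialOvoid = ¬ L₀ × (∀ (x y : H) → proj₁ x ≢ proj₁ y → ¬ Collinear (proj₁ x) (proj₁ y))

  record IsSubgroupOfH (Y : G → Bool) : Set where
    field
      ⊆H  : ∀ g → Y g ≡ true → InH g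
      ε∈  : Y ε ≡ true
      ∙∈  : ∀ x y → Y x ≡ true → Y y ≡ true → Y (x ∙ y) ≡ true
      ⁻¹∈ : ∀ x → Y x ≡ true → Y (x ⁻¹) ≡ true

  Elems : (G → Bool) → Set
  Elems Y = Σ G λ g → Y g ≡ true

  OnCommonLine : (G → Bool) → Set
  OnCommonLine Y = ∃[ l ] (∀ g → Y g ≡ true → inc g l ≡ true)

  data Gen (X : G → Bool) (g : G) : G → Set where
    gen-X   : ∀ x → X x ≡ true → Gen X g x
    gen-g   : Gen X g g
    gen-ε   : Gen X g ε
    gen-∙   : ∀ {x y} → Gen X g x → Gen X g y → Gen X g (x ∙ y)
    gen-⁻¹  : ∀ {x} → Gen X g x → Gen X g (x ⁻¹)

  CaseA : Set
  CaseA = PartialOvoid × ∃[ n ] (HasSize H n × n ≤ 1 + s * t)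

  CaseB : Set
  CaseB = (∃[ l ] ∀ (x : H) → inc (proj₁ x) l ≡ true)
        × ∃[ n ] (HasSize H n × n ∣ 1 + s)

  CaseC : Set
  CaseC = ∃[ s₁ ] ∃[ s₂ ] (Sθ ≅ Grid s₁ s₂ × ∃[ Y₁ ] ∃[ Y₂ ]
    ( IsSubgroupOfH Y₁ × IsSubgroupOfH Y₂
    × (∀ h → InH h → ∃[ y₁ ] ∃[ y₂ ] (Y₁ y₁ ≡ true × Y₂ y₂ ≡ true × h ≡ y₁ ∙ y₂))
    × HasSize (Elems Y₁) (suc s₁) × HasSize (Elems Y₂) (suc s₂)
    × suc s₁ ∣ suc s × suc s₂ ∣ suc s
    × OnCommonLine Y₁ × OnCommonLine Y₂))

  CaseC' : Set
  CaseC' = ∃[ s₁ ] (IsGQ Sθ s₁ 1 × s₁ ≤ s ⊓ t × ∃[ X₁ ] ∃[ g₁ ]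
    ( IsSubgroupOfH X₁ × InH g₁
    × (∃[ k ] (HasSize (Elems X₁) k × 2 * k ≡ suc s₁))
    × (∀ h → InH h ⇔ Gen X₁ g₁ h)
    × ∃[ l₁ ] ∃[ l₂ ]
      ( φ l₁ ≡ l₁ × φ l₂ ≡ l₂ × l₁ ≢ l₂ × inc ε l₁ ≡ true × inc ε l₂ ≡ true
      × (∀ h → InH h → (inc h l₁ ≡ true ⇔
            (X₁ h ≡ true ⊎ ∃[ x ] (X₁ x ≡ true × h ≡ g₁ ∙ x))))
      × (∀ h → InH h → (inc h l₂ ≡ true ⇔
            (∃[ x ] (X₁ x ≡ true × h ≡ (g₁ ∙ x) ∙ (g₁ ⁻¹))
             ⊎ ∃[ x ] (X₁ x ≡ true × h ≡ x ∙ (g₁ ⁻¹))))))))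

  CaseD : Set
  CaseD = ∃[ t₁ ] (IsGQ Sθ 1 t₁ × 2 ≤ t₁ × t₁ ≤ s ⊓ t × ∃[ K ]
    ( IsSubgroupOfH K
    × ∃[ n ] ∃[ k ] (HasSize H n × HasSize (Elems K) k × n ≡ 2 * k)
    × (∀ x y → K x ≡ true → K y ≡ true → x ≢ y → ¬ Collinear x y)))

  CaseE : Set
  CaseE = ∃[ s' ] ∃[ t' ] (IsGQ Sθ s' t' × 2 ≤ s' × 2 ≤ t')

  Conclusion : Set
  Conclusion = (∀ g → InH g → g ≡ ε)
             ⊎ (∃[ n ] (HasSize H n × 1 < n)
                × (CaseA ⊎ CaseB ⊎ CaseC ⊎ CaseC' ⊎ CaseD ⊎ CaseE))

{-# OPTIONS --safe #-}

-- H acts by right multiplication on the fixed substructure, regularly on its points, and every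
-- projection of a fixed point to a fixed line is fixed. If the fixed points are not on a common
-- line and some line is fixed, then transitivity gives every fixed line at least two fixed points
-- and every fixed point the same number T ≥ 2 of fixed lines. For T ≥ 3 all fixed lines are of the
-- same size, and one gets a subquadrangle; for T = 2 one gets a grid, and the cases (c) and (c')
-- are told apart by whether the fixed points on a line through 1 stabilise that line.
-- The bounds on the thin subquadrangles are the inequality of Payne and Thas (a subquadrangle of
-- order (s', t') with s' < s has s' t' ≤ s) for the quadrangle and its dual. It follows from
-- Σ f² ≥ 0 for f = (s + 1) ((s + t) v − N Nᵀ v) + |W|, where N is the incidence matrix and v the
-- indicator function of the point set W of the subquadrangle.
module Submission where

open import Defs
import Algebra.Properties.Group as GroupProperties
import Algebra.Properties.Semiring.Sum as SemiringSum
import Data.Bool.Properties as Bool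
import Data.Fin.Properties as Fin
import Data.Integer.Properties as ℤ
import Data.Nat.Properties as ℕ
open import Algebra.Bundles using (AbelianGroup; Group)
open import Algebra.Morphism.Structures using (module GroupMorphisms)
open import Algebra.Structures using (IsGroup)
open import Axiom.UniquenessOfIdentityProofs.WithK using (uip)
open import Data.Bool using (Bool; true; false; if_then_else_; _∧_)
open import Data.Empty using (⊥; ⊥-elim)
open import Data.Fin as Fin using (Fin; zero; suc)
open import Data.Fin.Permutation using (↔⇒≡)
open import Data.Integer as ℤ using (ℤ; +_; 0ℤ; 1ℤ)
open import Data.Integer.Tactic.RingSolver using (solve-∀)
open import Data.List.Base using (List; []; _∷_; lookup)
open import Data.List.Membership.Propositional.Properties using (∈-lookup)
open import Data.List.Relation.Unary.All as All using ([]; _∷_)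
open import Data.List.Relation.Unary.AllPairs using ([]; _∷_)
open import Data.List.Relation.Unary.Unique.Propositional using (Unique)
open import Data.Nat as ℕ using (ℕ; zero; suc)
open import Data.Nat.Divisibility using (_∣_; divides)
open import Data.Product using (Σ; ∃; ∃-syntax; _×_; _,_; proj₁; proj₂)
open import Data.Product.Function.NonDependent.Propositional using (_×-↔_)
open import Data.Sum as Sum using (_⊎_; inj₁; inj₂; [_,_]′)
open import Data.Sum.Function.Propositional using (_⊎-↔_)
open import Data.Sum.Properties using (inj₁-injective; inj₂-injective)
open import Function.Base using (_∘_)
open import Function.Bundles using (_↔_; Inverse; mk↔ₛ′; mk⤖; mk⇔)
open import Function.Construct.Composition using (_↔-∘_)
open import Function.Construct.Symmetry using (↔-sym)
open import Function.Definitions using (Injective)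
open import Function.Properties.Bijection using (⤖⇒↔)
open import Level using (0ℓ)
open import Relation.Binary.Definitions using (DecidableEquality)
open import Relation.Binary.PropositionalEquality
open import Relation.Nullary using (¬_; Dec; yes; no; does)
open import Relation.Nullary.Decidable using (map′; dec-true; dec-false; _×-dec_; _⊎-dec_; _→-dec_; ¬?)

-- Translation by an element of H commutes with θ, but H can have several orbits on the fixed lines;
-- so transitivity on the fixed points leaves the line sizes open. Projection is a bijection between
-- disjoint lines only. Concurrent lines are compared through a line disjoint from both, and the
-- construction of that line takes a third line through a point. This is why T = 2 is special: the
-- two sides of a grid may differ in size. They agree if an element of H interchanges the two
-- classes of lines, and a point g₁ of H on the line l₁ through 1 does so as soon as it moves l₁. If
-- no such point exists, the points of H on either line through 1 form a subgroup, the stabiliser of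
-- that line in H.
--
-- The inequality is used only for the value 1 of one parameter, where its strictness hypothesis is
-- thickness. It then bounds t₁ by s in (d) and, in dual form, s₁ by t in (c'); the bounds of t₁ by
-- t and of s₁ by s are immediate counts on one point or one line.

module Summation = SemiringSum ℤ.+-*-semiring
open GroupProperties (AbelianGroup.group ℤ.+-0-abelianGroup) using () renaming (∙-cancelʳ to +-cancelʳ)

-- Finite types: subsets, decidable search, cardinalities.

-- Subsets are encoded by an equation between two functions, and by `uip` the proof of membership
-- carries no information. Fixed points, fixed lines and sets given by a `Bool`-valued function are
-- all of this form.
Σ≡ : {A B : Set} {f g : A → B} {x y : Σ A (λ a → f a ≡ g a)} → proj₁ x ≡ proj₁ y → x ≡ y
Σ≡ {x = a , p} {y = .a , q} refl = cong (a ,_) (uip p q)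

inj-surj⇒↔ : {A B : Set} (f : A → B) → Injective _≡_ _≡_ f → (∀ b → ∃ λ a → f a ≡ b) → A ↔ B
inj-surj⇒↔ f inj surj = ⤖⇒↔ (mk⤖ (inj , λ b → proj₁ (surj b) , λ { refl → proj₂ (surj b) }))

↔-injective : {A B : Set} (e : A ↔ B) → Injective _≡_ _≡_ (Inverse.to e)
↔-injective e {x} {y} p = trans (sym (strictlyInverseʳ x)) (trans (cong from p) (strictlyInverseʳ y))
  where open Inverse e

does⇒ : {A : Set} (d : Dec A) → does d ≡ true → A
does⇒ (yes a) _ = a

module _ {A : Set} {n : ℕ} (e : HasSize A n) where
  open Inverse e

  finite-≟ : DecidableEquality A
  finite-≟ a b = map′ (↔-injective e) (cong to) (to a Fin.≟ to b)

  search : {P : A → Set} → (∀ a → Dec (P a)) → Dec (∃ P)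
  search {P} P? = map′ (λ (i , p) → from i , p) (λ (a , p) → to a , subst P (sym (strictlyInverseʳ a)) p)
                       (Fin.any? (P? ∘ from))

  forall? : {P : A → Set} → (∀ a → Dec (P a)) → Dec (∀ a → P a)
  forall? {P} P? = map′ (λ p a → subst P (strictlyInverseʳ a) (p (to a))) (λ p i → p (from i))
                        (Fin.all? (P? ∘ from))

  counterexample : {P : A → Set} → (∀ a → Dec (P a)) → ¬ (∀ a → P a) → ∃ λ a → ¬ P a
  counterexample {P} P? ¬all with Fin.¬∀⟶∃¬ n (P ∘ from) (P? ∘ from) (λ p → ¬all (λ a → subst P (strictlyInverseʳ a) (p (to a))))
  ... | i , ¬p = from i , ¬p

size-unique : {A : Set} {m n : ℕ} → HasSize A m → HasSize A n → m ≡ n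
size-unique e f = ↔⇒≡ (f ↔-∘ ↔-sym e)

size-mono : {A B : Set} {m n : ℕ} → HasSize A m → HasSize B n → (f : A → B) → Injective _≡_ _≡_ f → m ℕ.≤ n
size-mono e e′ f inj = Fin.injective⇒≤ {f = Inverse.to e′ ∘ f ∘ Inverse.from e}
  (λ p → ↔-injective (↔-sym e) (inj (↔-injective e′ p)))

size-⊎ : {A B : Set} {m n : ℕ} → HasSize A m → HasSize B n → HasSize (A ⊎ B) (m ℕ.+ n)
size-⊎ e f = ↔-sym Fin.+↔⊎ ↔-∘ (e ⊎-↔ f)

size-× : {A B : Set} {m n : ℕ} → HasSize A m → HasSize B n → HasSize (A × B) (m ℕ.* n)
size-× e f = ↔-sym Fin.*↔× ↔-∘ (e ×-↔ f)

count : ∀ {n} → (Fin n → Bool) → ℕ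
count {zero}  p = 0
count {suc n} p = (if p zero then 1 else 0) ℕ.+ count (p ∘ suc)

count-size : ∀ {n} (p : Fin n → Bool) → HasSize (Σ (Fin n) λ i → p i ≡ true) (count p)
count-size {zero}  p = mk↔ₛ′ (λ ()) (λ ()) (λ ()) (λ ())
count-size {suc n} p with p zero in eq
... | true  = mk↔ₛ′ f g fg gf
  where
  e = count-size (p ∘ suc)
  open Inverse e
  f : Σ (Fin (suc n)) (λ i → p i ≡ true) → Fin (suc (count (p ∘ suc)))
  f (zero  , _) = zero
  f (suc i , q) = suc (to (i , q))
  g : Fin (suc (count (p ∘ suc))) → Σ (Fin (suc n)) (λ i → p i ≡ true)
  g zero = zero , eq
  g (suc j) = suc (proj₁ (from j)) , proj₂ (from j)
  fg : ∀ j → f (g j) ≡ j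
  fg zero = refl
  fg (suc j) = cong suc (strictlyInverseˡ j)
  gf : ∀ x → g (f x) ≡ x
  gf (zero , q) = Σ≡ refl
  gf (suc i , q) = Σ≡ (cong (suc ∘ proj₁) (strictlyInverseʳ (i , q)))
... | false = mk↔ₛ′ f g strictlyInverseˡ gf
  where
  e = count-size (p ∘ suc)
  open Inverse e
  f : Σ (Fin (suc n)) (λ i → p i ≡ true) → Fin (count (p ∘ suc))
  f (zero , q) with () ← trans (sym eq) q
  f (suc i , q) = to (i , q)
  g : Fin (count (p ∘ suc)) → Σ (Fin (suc n)) (λ i → p i ≡ true)
  g j = suc (proj₁ (from j)) , proj₂ (from j)
  gf : ∀ x → g (f x) ≡ x
  gf (zero , q) with () ← trans (sym eq) q
  gf (suc i , q) = Σ≡ (cong (suc ∘ proj₁) (strictlyInverseʳ (i , q)))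

module _ {A : Set} {n : ℕ} (e : HasSize A n) where
  open Inverse e

  Bool-subset-size : (p : A → Bool) → HasSize (Σ A λ a → p a ≡ true) (count (p ∘ from))
  Bool-subset-size p = count-size (p ∘ from) ↔-∘
    mk↔ₛ′ (λ (a , q) → to a , trans (cong p (strictlyInverseʳ a)) q)
          (λ (i , q) → from i , q)
          (λ (i , _) → Σ≡ (strictlyInverseˡ i))
          (λ (a , _) → Σ≡ (strictlyInverseʳ a))

subset-size : {A B : Set} {n : ℕ} {f g : A → B} → HasSize A n → DecidableEquality B →
              ∃ λ k → HasSize (Σ A λ a → f a ≡ g a) k
subset-size {A} {f = f} {g} e _≟_ = _ , Bool-subset-size e (λ a → does (f a ≟ g a)) ↔-∘
  mk↔ₛ′ (λ (a , q) → a , dec-true (f a ≟ g a) q) (λ (a , q) → a , does⇒ (f a ≟ g a) q)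
        (λ _ → Σ≡ refl) (λ _ → Σ≡ refl)

-- Integer sums over finite types.

module FiniteSums where
  open import Data.Integer using (_+_; _*_; _≤_)

  ⟦_⟧ : Bool → ℤ
  ⟦ true ⟧  = 1ℤ
  ⟦ false ⟧ = 0ℤ

  opaque
    ∑ : {A : Set} {n : ℕ} → HasSize A n → (A → ℤ) → ℤ
    ∑ e f = Summation.sum (f ∘ Inverse.from e)

  module _ {A : Set} {n : ℕ} (e : HasSize A n) where
    open Inverse e

    opaque
      unfolding ∑

      ∑-cong : {f g : A → ℤ} → (∀ a → f a ≡ g a) → ∑ e f ≡ ∑ e g
      ∑-cong h = Summation.sum-cong-≗ (h ∘ from)

      ∑-+ : (f g : A → ℤ) → ∑ e (λ a → f a + g a) ≡ ∑ e f + ∑ e g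
      ∑-+ f g = Summation.∑-distrib-+ (f ∘ from) (g ∘ from)

      ∑-*ˡ : (c : ℤ) (f : A → ℤ) → ∑ e (λ a → c * f a) ≡ c * ∑ e f
      ∑-*ˡ c f = sym (Summation.*-distribˡ-sum c (f ∘ from))

      ∑-*ʳ : (c : ℤ) (f : A → ℤ) → ∑ e (λ a → f a * c) ≡ ∑ e f * c
      ∑-*ʳ c f = sym (Summation.*-distribʳ-sum c (f ∘ from))

      ∑-const : (c : ℤ) → ∑ e (λ _ → c) ≡ + n * c
      ∑-const c = go n
        where
        go : ∀ m → Summation.sum {m} (λ _ → c) ≡ + m * c
        go zero    = sym (ℤ.*-zeroˡ c)
        go (suc m) = trans (cong (λ r → c + r) (go m)) (sym (ℤ.suc-* (+ m) c))

      ∑-single : {f : A → ℤ} (b : A) → (∀ a → a ≢ b → f a ≡ 0ℤ) → ∑ e f ≡ f b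
      ∑-single {f} b h = trans (go (to b) (f ∘ from) λ i i≢ → h (from i) (λ q → i≢ (trans (sym (strictlyInverseˡ i)) (cong to q))))
                               (cong f (strictlyInverseʳ b))
        where
        zeros : ∀ {m} (k : Fin m → ℤ) → (∀ i → k i ≡ 0ℤ) → Summation.sum k ≡ 0ℤ
        zeros {m} k z = trans (Summation.sum-cong-≗ z) (Summation.sum-replicate-zero m)
        go : ∀ {m} (j : Fin m) (k : Fin m → ℤ) → (∀ i → i ≢ j → k i ≡ 0ℤ) → Summation.sum k ≡ k j
        go zero k z = trans (cong (λ r → k zero + r) (zeros (k ∘ suc) (λ i → z (suc i) (λ ())))) (ℤ.+-identityʳ _)
        go (suc j) k z = trans (cong₂ _+_ (z zero (λ ())) (go j (k ∘ suc) (λ i q → z (suc i) (q ∘ Fin.suc-injective)))) (ℤ.+-identityˡ _)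

      ∑-mono : {f g : A → ℤ} → (∀ a → f a ≤ g a) → ∑ e f ≤ ∑ e g
      ∑-mono {f} {g} h = go n (f ∘ from) (g ∘ from) (h ∘ from)
        where
        go : ∀ m (f g : Fin m → ℤ) → (∀ i → f i ≤ g i) → Summation.sum f ≤ Summation.sum g
        go zero f g h = ℤ.≤-refl
        go (suc m) f g h = ℤ.+-mono-≤ (h zero) (go m (f ∘ suc) (g ∘ suc) (h ∘ suc))

      ∑-count : {k : ℕ} (p : A → Bool) → HasSize (Σ A λ a → p a ≡ true) k → ∑ e (λ a → ⟦ p a ⟧) ≡ + k
      ∑-count p e′ = trans (go (p ∘ from)) (cong +_ (size-unique (Bool-subset-size e p) e′))
        where
        go : ∀ {m} (q : Fin m → Bool) → Summation.sum (λ i → ⟦ q i ⟧) ≡ + count q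
        go {zero}  q = refl
        go {suc m} q with q zero
        ... | true  = cong (λ r → 1ℤ + r) (go (q ∘ suc))
        ... | false = cong (λ r → 0ℤ + r) (go (q ∘ suc))

    ∑-zero : {f : A → ℤ} → (∀ a → f a ≡ 0ℤ) → ∑ e f ≡ 0ℤ
    ∑-zero h = trans (∑-cong h) (trans (∑-const 0ℤ) (ℤ.*-zeroʳ (+ n)))

  opaque
    unfolding ∑

    ∑-swap : {A B : Set} {m n : ℕ} (eA : HasSize A m) (eB : HasSize B n) (f : A → B → ℤ) →
             ∑ eA (λ a → ∑ eB (f a)) ≡ ∑ eB (λ b → ∑ eA (λ a → f a b))
    ∑-swap eA eB f = Summation.∑-comm (λ i j → f (Inverse.from eA i) (Inverse.from eB j))

  ⟦∧⟧ : ∀ a b → ⟦ a ∧ b ⟧ ≡ ⟦ a ⟧ * ⟦ b ⟧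
  ⟦∧⟧ true  true  = refl
  ⟦∧⟧ true  false = refl
  ⟦∧⟧ false b     = refl

  ⟦⟧-idem : ∀ a → ⟦ a ⟧ * ⟦ a ⟧ ≡ ⟦ a ⟧
  ⟦⟧-idem true  = refl
  ⟦⟧-idem false = refl

open FiniteSums

-- Generalized quadrangles as point-line geometries.

-- The order is left out on purpose: the fixed substructure satisfies these axioms before its line
-- sizes are known to be constant, and so does a grid with unequal sides. The disjunction in
-- `unique` keeps the axioms visibly self-dual.
record GQAxioms {P L : Set} (inc : P → L → Bool) : Set where
  field
    unique : ∀ {x y l m} → inc x l ≡ true → inc y l ≡ true → inc x m ≡ true → inc y m ≡ true → x ≡ y ⊎ l ≡ m
    project : ∀ x l → inc x l ≢ true → ∃[ y ] ∃[ m ] (inc x m ≡ true × inc y m ≡ true × inc y l ≡ true)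
    project-unique : ∀ {x l y m y′ m′} → inc x l ≢ true →
      inc x m ≡ true → inc y m ≡ true → inc y l ≡ true →
      inc x m′ ≡ true → inc y′ m′ ≡ true → inc y′ l ≡ true → y ≡ y′ × m ≡ m′

  unique-ln : ∀ {x y l m} → x ≢ y → inc x l ≡ true → inc y l ≡ true → inc x m ≡ true → inc y m ≡ true → l ≡ m
  unique-ln x≢y a b c d with unique a b c d
  ... | inj₁ x≡y = ⊥-elim (x≢y x≡y)
  ... | inj₂ l≡m = l≡m

  unique-pt : ∀ {x y l m} → l ≢ m → inc x l ≡ true → inc y l ≡ true → inc x m ≡ true → inc y m ≡ true → x ≡ y
  unique-pt l≢m a b c d with unique a b c d
  ... | inj₁ x≡y = x≡y
  ... | inj₂ l≡m = ⊥-elim (l≢m l≡m)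

dual-axioms : {P L : Set} {inc : P → L → Bool} → GQAxioms inc → GQAxioms (λ l x → inc x l)
dual-axioms ax = record
  { unique = λ a b c d → [ inj₂ , inj₁ ]′ (unique a c b d)
  ; project = λ l x ¬i → let y , m , a , b , c = project x l ¬i in m , y , c , b , a
  ; project-unique = λ ¬i a b c a′ b′ c′ → let p , q = project-unique ¬i c b a c′ b′ a′ in q , p
  }
  where open GQAxioms ax

-- Counting with the incidence matrix N.

module Counting {P L : Set} {inc : P → L → Bool} (ax : GQAxioms inc)
                {nP nL : ℕ} (eP : HasSize P nP) (eL : HasSize L nL) {s′ t′ : ℕ}
                (line-size : ∀ l → HasSize (Σ P λ x → inc x l ≡ true) (suc s′))
                (point-size : ∀ x → HasSize (Σ L λ l → inc x l ≡ true) (suc t′)) where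
  open GQAxioms ax
  open import Data.Integer using (_+_; _*_; _-_; -_; _≤_)

  s t : ℤ
  s = + s′
  t = + t′

  N : P → L → ℤ
  N x l = ⟦ inc x l ⟧

  ∑-line : ∀ l → ∑ eP (λ x → N x l) ≡ 1ℤ + s
  ∑-line l = ∑-count eP (λ x → inc x l) (line-size l)

  ∑-point : ∀ x → ∑ eL (λ l → N x l) ≡ 1ℤ + t
  ∑-point x = ∑-count eL (inc x) (point-size x)

  -- The entries of Nᵀ N: s + 1 on the diagonal, and otherwise 1 or 0 as the lines meet or not.
  meet : L → L → ℤ
  meet m l = ∑ eP (λ y → N y m * N y l)

  private
    N-on : ∀ {x l} → inc x l ≡ true → N x l ≡ 1ℤ
    N-on = cong ⟦_⟧

    N-off : ∀ {x l} → inc x l ≢ true → N x l ≡ 0ℤ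
    N-off = cong ⟦_⟧ ∘ Bool.¬-not

    on-off : ∀ b → b ≡ true ⊎ b ≢ true
    on-off true  = inj₁ refl
    on-off false = inj₂ (λ ())

  meet-self : ∀ l → meet l l ≡ 1ℤ + s
  meet-self l = trans (∑-cong eP (λ y → ⟦⟧-idem (inc y l))) (∑-line l)

  meet-at : ∀ {y m l} → m ≢ l → inc y m ≡ true → inc y l ≡ true → meet m l ≡ 1ℤ
  meet-at {y} {m} {l} m≢l i j = trans (∑-single eP y off) (cong₂ _*_ (N-on i) (N-on j))
    where
    off : ∀ z → z ≢ y → N z m * N z l ≡ 0ℤ
    off z z≢y with on-off (inc z m) | on-off (inc z l)
    ... | inj₁ p | inj₁ q = ⊥-elim (z≢y (unique-pt m≢l p i q j))
    ... | inj₂ p | _      = trans (cong (_* N z l) (N-off p)) (ℤ.*-zeroˡ (N z l))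
    ... | inj₁ _ | inj₂ q = trans (cong (N z m *_) (N-off q)) (ℤ.*-zeroʳ (N z m))

  meet-none : ∀ {m l} → (∀ y → inc y m ≡ true → inc y l ≢ true) → meet m l ≡ 0ℤ
  meet-none {m} {l} h = ∑-zero eP off
    where
    off : ∀ z → N z m * N z l ≡ 0ℤ
    off z with on-off (inc z m)
    ... | inj₁ p = trans (cong (N z m *_) (N-off (h z p))) (ℤ.*-zeroʳ (N z m))
    ... | inj₂ p = trans (cong (_* N z l) (N-off p)) (ℤ.*-zeroˡ (N z l))

  -- The matrix identity N Nᵀ N = (s + t) N + J.
  NNᵀN : ∀ z l → ∑ eL (λ m → N z m * meet m l) ≡ 1ℤ + (s + t) * N z l
  NNᵀN z l with on-off (inc z l)
  ... | inj₁ z∈l = begin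
      ∑ eL (λ m → N z m * meet m l)                   ≡⟨ ∑-cong eL term ⟩
      ∑ eL (λ m → N z m + extra m)                    ≡⟨ ∑-+ eL (N z) extra ⟩
      ∑ eL (λ m → N z m) + ∑ eL extra                 ≡⟨ cong₂ _+_ (∑-point z) (trans (∑-single eL l extra-off) extra-on) ⟩
      1ℤ + t + s                                      ≡⟨ arith s t ⟩
      1ℤ + (s + t) * 1ℤ                               ≡⟨ cong (λ r → 1ℤ + (s + t) * r) (sym (N-on z∈l)) ⟩
      1ℤ + (s + t) * N z l                            ∎
    where
    open ≡-Reasoning
    _≟_ = finite-≟ eL
    -- Each line through z meets l in z alone and contributes 1, except l itself, which contributes
    -- s + 1; this is the surplus.
    extra : L → ℤ
    extra m = if does (m ≟ l) then s else 0ℤ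
    extra-on : extra l ≡ s
    extra-on = cong (λ b → if b then s else 0ℤ) (dec-true (l ≟ l) refl)
    extra-off : ∀ m → m ≢ l → extra m ≡ 0ℤ
    extra-off m m≢l = cong (λ b → if b then s else 0ℤ) (dec-false (m ≟ l) m≢l)
    arith : ∀ s t → 1ℤ + t + s ≡ 1ℤ + (s + t) * 1ℤ
    arith = solve-∀
    term : ∀ m → N z m * meet m l ≡ N z m + extra m
    term m with m ≟ l
    ... | yes refl = trans (cong₂ _*_ (N-on z∈l) (meet-self l))
                           (trans (ℤ.*-identityˡ _) (cong₂ _+_ (sym (N-on z∈l)) (sym extra-on)))
    ... | no m≢l = trans (ordinary m≢l (on-off (inc z m)))
                         (trans (sym (ℤ.+-identityʳ _)) (cong (λ r → N z m + r) (sym (extra-off m m≢l))))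
      where
      ordinary : m ≢ l → inc z m ≡ true ⊎ inc z m ≢ true → N z m * meet m l ≡ N z m
      ordinary m≢l (inj₁ z∈m) = trans (cong (N z m *_) (meet-at m≢l z∈m z∈l)) (ℤ.*-identityʳ _)
      ordinary m≢l (inj₂ z∉m) = trans (cong (_* meet m l) (N-off z∉m)) (trans (ℤ.*-zeroˡ (meet m l)) (sym (N-off z∉m)))
  ... | inj₂ z∉l with project z l z∉l
  -- By uniqueness of the projection, k is the only line through z that meets l, so a single term
  -- survives.
  ...   | y , k , z∈k , y∈k , y∈l = begin
      ∑ eL (λ m → N z m * meet m l)   ≡⟨ ∑-single eL k off ⟩
      N z k * meet k l                ≡⟨ cong₂ _*_ (N-on z∈k) (meet-at (λ { refl → z∉l z∈k }) y∈k y∈l) ⟩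
      1ℤ                              ≡⟨ sym (trans (cong (λ r → 1ℤ + r) (ℤ.*-zeroʳ (s + t))) refl) ⟩
      1ℤ + (s + t) * 0ℤ               ≡⟨ cong (λ r → 1ℤ + (s + t) * r) (sym (N-off z∉l)) ⟩
      1ℤ + (s + t) * N z l            ∎
    where
    open ≡-Reasoning
    off : ∀ m → m ≢ k → N z m * meet m l ≡ 0ℤ
    off m m≢k with on-off (inc z m)
    ... | inj₂ z∉m = trans (cong (_* meet m l) (N-off z∉m)) (ℤ.*-zeroˡ (meet m l))
    ... | inj₁ z∈m = trans (cong (N z m *_) (meet-none (λ w w∈m w∈l →
                       m≢k (proj₂ (project-unique z∉l z∈m w∈m w∈l z∈k y∈k y∈l))))) (ℤ.*-zeroʳ (N z m))

  -- Sum the matrix identity over all points z.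
  point-count : L → + nP ≡ (1ℤ + s) * (1ℤ + s * t)
  point-count l = +-cancelʳ ((s + t) * (1ℤ + s)) (+ nP) ((1ℤ + s) * (1ℤ + s * t)) (begin
    + nP + (s + t) * (1ℤ + s)
      ≡⟨ cong₂ _+_ (sym (trans (∑-const eP 1ℤ) (ℤ.*-identityʳ (+ nP)))) (sym (trans (∑-*ˡ eP (s + t) (λ z → N z l)) (cong ((s + t) *_) (∑-line l)))) ⟩
    ∑ eP (λ _ → 1ℤ) + ∑ eP (λ z → (s + t) * N z l)        ≡⟨ sym (∑-+ eP (λ _ → 1ℤ) (λ z → (s + t) * N z l)) ⟩
    ∑ eP (λ z → 1ℤ + (s + t) * N z l)                     ≡⟨ ∑-cong eP (λ z → sym (NNᵀN z l)) ⟩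
    ∑ eP (λ z → ∑ eL (λ m → N z m * meet m l))            ≡⟨ ∑-swap eP eL _ ⟩
    ∑ eL (λ m → ∑ eP (λ z → N z m * meet m l))            ≡⟨ ∑-cong eL (λ m → trans (∑-*ʳ eP (meet m l) (λ z → N z m)) (cong (_* meet m l) (∑-line m))) ⟩
    ∑ eL (λ m → (1ℤ + s) * meet m l)                      ≡⟨ ∑-*ˡ eL (1ℤ + s) (λ m → meet m l) ⟩
    (1ℤ + s) * ∑ eL (λ m → meet m l)                      ≡⟨ cong ((1ℤ + s) *_) (∑-swap eL eP _) ⟩
    (1ℤ + s) * ∑ eP (λ y → ∑ eL (λ m → N y m * N y l))
      ≡⟨ cong ((1ℤ + s) *_) (∑-cong eP (λ y → trans (∑-*ʳ eL (N y l) (N y)) (cong (_* N y l) (∑-point y)))) ⟩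
    (1ℤ + s) * ∑ eP (λ y → (1ℤ + t) * N y l)
      ≡⟨ cong ((1ℤ + s) *_) (trans (∑-*ˡ eP (1ℤ + t) (λ y → N y l)) (cong ((1ℤ + t) *_) (∑-line l))) ⟩
    (1ℤ + s) * ((1ℤ + t) * (1ℤ + s))                      ≡⟨ arith s t ⟩
    (1ℤ + s) * (1ℤ + s * t) + (s + t) * (1ℤ + s)          ∎)
    where
    open ≡-Reasoning
    arith : ∀ s t → (1ℤ + s) * ((1ℤ + t) * (1ℤ + s)) ≡ (1ℤ + s) * (1ℤ + s * t) + (s + t) * (1ℤ + s)
    arith = solve-∀

  number-of-points : L → nP ≡ suc s′ ℕ.* suc (s′ ℕ.* t′)
  number-of-points l = ℤ.+-injective (trans (point-count l)
    (trans (cong (λ r → (1ℤ + s) * (1ℤ + r)) (sym (ℤ.pos-* s′ t′))) (sym (ℤ.pos-* (suc s′) (suc (s′ ℕ.* t′))))))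

  -- For a set of points with indicator function v, a z is the z-entry of N Nᵀ v.
  module Variance (l₀ : L) (W : P → Bool) {k : ℕ} (sizeW : HasSize (Σ P λ x → W x ≡ true) k) where

    v : P → ℤ
    v x = ⟦ W x ⟧

    σ : ℤ
    σ = + k

    -- This is Nᵀ v, the number of points of W on each line. Accordingly `q` is its squared norm,
    -- that is vᵀ N Nᵀ v.
    u : L → ℤ
    u l = ∑ eP (λ x → N x l * v x)

    a : P → ℤ
    a x = ∑ eL (λ l → N x l * u l)

    q : ℤ
    q = ∑ eL (λ l → u l * u l)

    ∑v : ∑ eP v ≡ σ
    ∑v = ∑-count eP W sizeW

    ∑vv : ∑ eP (λ x → v x * v x) ≡ σ
    ∑vv = trans (∑-cong eP (⟦⟧-idem ∘ W)) ∑v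

    ∑u : ∑ eL u ≡ (1ℤ + t) * σ
    ∑u = begin
      ∑ eL (λ l → ∑ eP (λ x → N x l * v x))   ≡⟨ ∑-swap eL eP _ ⟩
      ∑ eP (λ x → ∑ eL (λ l → N x l * v x))   ≡⟨ ∑-cong eP (λ x → trans (∑-*ʳ eL (v x) (N x)) (cong (_* v x) (∑-point x))) ⟩
      ∑ eP (λ x → (1ℤ + t) * v x)             ≡⟨ ∑-*ˡ eP (1ℤ + t) v ⟩
      (1ℤ + t) * ∑ eP v                       ≡⟨ cong ((1ℤ + t) *_) ∑v ⟩
      (1ℤ + t) * σ                            ∎
      where open ≡-Reasoning

    ∑a : ∑ eP a ≡ (1ℤ + s) * ((1ℤ + t) * σ)
    ∑a = begin
      ∑ eP (λ x → ∑ eL (λ l → N x l * u l))   ≡⟨ ∑-swap eP eL _ ⟩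
      ∑ eL (λ l → ∑ eP (λ x → N x l * u l))   ≡⟨ ∑-cong eL (λ l → trans (∑-*ʳ eP (u l) (λ x → N x l)) (cong (_* u l) (∑-line l))) ⟩
      ∑ eL (λ l → (1ℤ + s) * u l)             ≡⟨ ∑-*ˡ eL (1ℤ + s) u ⟩
      (1ℤ + s) * ∑ eL u                       ≡⟨ cong ((1ℤ + s) *_) ∑u ⟩
      (1ℤ + s) * ((1ℤ + t) * σ)               ∎
      where open ≡-Reasoning

    -- The adjointness of N and Nᵀ, applied to N u. Taking for f the vector v, a column of N and `a`
    -- itself yields the next three sums.
    adjoint : (f : P → ℤ) → ∑ eP (λ x → f x * a x) ≡ ∑ eL (λ l → u l * ∑ eP (λ x → N x l * f x))
    adjoint f = begin
      ∑ eP (λ x → f x * a x)                            ≡⟨ ∑-cong eP (λ x → sym (∑-*ˡ eL (f x) (λ l → N x l * u l))) ⟩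
      ∑ eP (λ x → ∑ eL (λ l → f x * (N x l * u l)))     ≡⟨ ∑-swap eP eL _ ⟩
      ∑ eL (λ l → ∑ eP (λ x → f x * (N x l * u l)))     ≡⟨ ∑-cong eL (λ l → trans (∑-cong eP (λ x → arith (f x) (N x l) (u l))) (∑-*ˡ eP (u l) (λ x → N x l * f x))) ⟩
      ∑ eL (λ l → u l * ∑ eP (λ x → N x l * f x))       ∎
      where
      open ≡-Reasoning
      arith : ∀ f n u → f * (n * u) ≡ u * (n * f)
      arith = solve-∀

    ∑va : ∑ eP (λ x → v x * a x) ≡ q
    ∑va = adjoint v

    -- The transposed matrix identity Nᵀ N Nᵀ = (s + t) Nᵀ + J, applied to v.
    ∑Na : ∀ l → ∑ eP (λ x → N x l * a x) ≡ (s + t) * u l + σ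
    ∑Na l = begin
      ∑ eP (λ x → N x l * a x)                              ≡⟨ adjoint (λ x → N x l) ⟩
      ∑ eL (λ m → u m * ∑ eP (λ x → N x m * N x l))         ≡⟨ ∑-cong eL (λ m → sym (∑-*ʳ eP (meet m l) (λ x → N x m * v x))) ⟩
      ∑ eL (λ m → ∑ eP (λ x → N x m * v x * meet m l))      ≡⟨ ∑-swap eL eP _ ⟩
      ∑ eP (λ x → ∑ eL (λ m → N x m * v x * meet m l))      ≡⟨ ∑-cong eP (λ x → trans (∑-cong eL (λ m → arith (N x m) (v x) (meet m l))) (∑-*ˡ eL (v x) (λ m → N x m * meet m l))) ⟩
      ∑ eP (λ x → v x * ∑ eL (λ m → N x m * meet m l))      ≡⟨ ∑-cong eP (λ x → trans (cong (v x *_) (NNᵀN x l)) (arith₂ (v x) (s + t) (N x l))) ⟩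
      ∑ eP (λ x → (s + t) * (N x l * v x) + v x)            ≡⟨ ∑-+ eP (λ x → (s + t) * (N x l * v x)) v ⟩
      ∑ eP (λ x → (s + t) * (N x l * v x)) + ∑ eP v         ≡⟨ cong₂ _+_ (∑-*ˡ eP (s + t) (λ x → N x l * v x)) ∑v ⟩
      (s + t) * u l + σ                                     ∎
      where
      open ≡-Reasoning
      arith : ∀ n v m → n * v * m ≡ v * (n * m)
      arith = solve-∀
      arith₂ : ∀ v c n → v * (1ℤ + c * n) ≡ c * (n * v) + v
      arith₂ = solve-∀

    ∑aa : ∑ eP (λ x → a x * a x) ≡ (s + t) * q + (1ℤ + t) * σ * σ
    ∑aa = begin
      ∑ eP (λ x → a x * a x)                          ≡⟨ adjoint a ⟩
      ∑ eL (λ l → u l * ∑ eP (λ x → N x l * a x))     ≡⟨ ∑-cong eL (λ l → trans (cong (u l *_) (∑Na l)) (arith (u l) (s + t) σ)) ⟩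
      ∑ eL (λ l → (s + t) * (u l * u l) + u l * σ)    ≡⟨ ∑-+ eL (λ l → (s + t) * (u l * u l)) (λ l → u l * σ) ⟩
      ∑ eL (λ l → (s + t) * (u l * u l)) + ∑ eL (λ l → u l * σ)
        ≡⟨ cong₂ _+_ (∑-*ˡ eL (s + t) (λ l → u l * u l)) (trans (∑-*ʳ eL σ u) (cong (_* σ) ∑u)) ⟩
      (s + t) * q + (1ℤ + t) * σ * σ                  ∎
      where
      open ≡-Reasoning
      arith : ∀ u c r → u * (c * u + r) ≡ c * (u * u) + u * r
      arith = solve-∀

    -- N Nᵀ has the eigenvalue (1 + s) (1 + t) on the constants, and its other eigenvalues are s + t
    -- and 0. Subtracting N Nᵀ from s + t kills the eigenspace of s + t, and the summand σ cancels
    -- the constant component. Thus f is (1 + s) (s + t) times the projection of v to the kernel of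
    -- N Nᵀ, which explains why ∑ f² comes out as (1 + s) (s + t) times ∑ f v.
    f : P → ℤ
    f x = (1ℤ + s) * ((s + t) * v x - a x) + σ

    variance-sum : ∑ eP (λ x → f x * f x) ≡ (1ℤ + s) * (s + t) * ((1ℤ + s) * ((s + t) * σ - q) + σ * σ)
    variance-sum = begin
      ∑ eP (λ x → f x * f x)
        ≡⟨ ∑-cong eP (λ x → expand (1ℤ + s) (s + t) (v x) (a x) σ) ⟩
      ∑ eP (λ x → c₁ * (v x * v x) + (c₂ * (a x * a x) + (c₃ * (v x * a x) + (c₄ * v x + (c₅ * a x + c₆)))))
        ≡⟨ split c₁ (λ x → v x * v x) (λ x → c₂ * (a x * a x) + (c₃ * (v x * a x) + (c₄ * v x + (c₅ * a x + c₆))))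
             (split c₂ (λ x → a x * a x) (λ x → c₃ * (v x * a x) + (c₄ * v x + (c₅ * a x + c₆)))
             (split c₃ (λ x → v x * a x) (λ x → c₄ * v x + (c₅ * a x + c₆))
             (split c₄ v (λ x → c₅ * a x + c₆) (split c₅ a (λ _ → c₆) (∑-const eP c₆))))) ⟩
      c₁ * ∑ eP (λ x → v x * v x) + (c₂ * ∑ eP (λ x → a x * a x) + (c₃ * ∑ eP (λ x → v x * a x) + (c₄ * ∑ eP v + (c₅ * ∑ eP a + + nP * c₆))))
        ≡⟨ cong₂ _+_ (cong (c₁ *_) ∑vv) (cong₂ _+_ (cong (c₂ *_) ∑aa) (cong₂ _+_ (cong (c₃ *_) ∑va)
             (cong₂ _+_ (cong (c₄ *_) ∑v) (cong₂ _+_ (cong (c₅ *_) ∑a) (cong (_* c₆) (point-count l₀)))))) ⟩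
      c₁ * σ + (c₂ * ((s + t) * q + (1ℤ + t) * σ * σ) + (c₃ * q + (c₄ * σ + (c₅ * ((1ℤ + s) * ((1ℤ + t) * σ)) + (1ℤ + s) * (1ℤ + s * t) * c₆))))
        ≡⟨ collect s t σ q ⟩
      (1ℤ + s) * (s + t) * ((1ℤ + s) * ((s + t) * σ - q) + σ * σ) ∎
      where
      open ≡-Reasoning
      -- The coefficients of v², a², v a, v, a and 1 in f², in this order.
      c₁ = (1ℤ + s) * (1ℤ + s) * ((s + t) * (s + t))
      c₂ = (1ℤ + s) * (1ℤ + s)
      c₃ = - (+ 2 * ((1ℤ + s) * (1ℤ + s)) * (s + t))
      c₄ = + 2 * (1ℤ + s) * (s + t) * σ
      c₅ = - (+ 2 * (1ℤ + s) * σ)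
      c₆ = σ * σ
      split : ∀ c (g h : P → ℤ) {r} → ∑ eP h ≡ r → ∑ eP (λ x → c * g x + h x) ≡ c * ∑ eP g + r
      split c g h p = trans (∑-+ eP (λ x → c * g x) h) (cong₂ _+_ (∑-*ˡ eP c g) p)
      expand : ∀ A B v a r → (A * (B * v - a) + r) * (A * (B * v - a) + r) ≡
               A * A * (B * B) * (v * v) + (A * A * (a * a) + (- (+ 2 * (A * A) * B) * (v * a) + (+ 2 * A * B * r * v + (- (+ 2 * A * r) * a + r * r))))
      expand = solve-∀
      collect : ∀ s t r q →
        (1ℤ + s) * (1ℤ + s) * ((s + t) * (s + t)) * r + ((1ℤ + s) * (1ℤ + s) * ((s + t) * q + (1ℤ + t) * r * r) +
        (- (+ 2 * ((1ℤ + s) * (1ℤ + s)) * (s + t)) * q + (+ 2 * (1ℤ + s) * (s + t) * r * r +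
        (- (+ 2 * (1ℤ + s) * r) * ((1ℤ + s) * ((1ℤ + t) * r)) + (1ℤ + s) * (1ℤ + s * t) * (r * r)))))
        ≡ (1ℤ + s) * (s + t) * ((1ℤ + s) * ((s + t) * r - q) + r * r)
      collect = solve-∀

    square-nonneg : ∀ i → 0ℤ ≤ i * i
    square-nonneg (+ m) = subst (0ℤ ≤_) (ℤ.pos-* m m) (ℤ.+≤+ ℕ.z≤n)
    square-nonneg (ℤ.-[1+ m ]) = ℤ.+≤+ ℕ.z≤n

    variance-nonneg : 0ℤ ≤ (1ℤ + s) * (s + t) * ((1ℤ + s) * ((s + t) * σ - q) + σ * σ)
    variance-nonneg = subst (0ℤ ≤_) variance-sum
      (subst (_≤ ∑ eP (λ x → f x * f x)) (∑-zero eP {f = λ _ → 0ℤ} (λ _ → refl)) (∑-mono eP (λ x → square-nonneg (f x))))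

-- The inequality for the order of a subquadrangle.

module Subquadrangle {P L : Set} {inc : P → L → Bool} (ax : GQAxioms inc)
    {nP nL : ℕ} (eP : HasSize P nP) (eL : HasSize L nL) {s t : ℕ}
    (line-size : ∀ l → HasSize (Σ P λ x → inc x l ≡ true) (suc s))
    (point-size : ∀ x → HasSize (Σ L λ l → inc x l ≡ true) (suc t))
    (l₀ : L) (W : P → Bool) (V : L → Bool) {s₁ t₁ kW kV : ℕ}
    (W-size : HasSize (Σ P λ x → W x ≡ true) kW)
    (V-size : HasSize (Σ L λ l → V l ≡ true) kV)
    (V-line : ∀ l → V l ≡ true → HasSize (Σ P λ x → inc x l ∧ W x ≡ true) (suc s₁))
    (other-line : ∀ {l x y} → V l ≢ true → W x ≡ true → W y ≡ true → inc x l ≡ true → inc y l ≡ true → x ≡ y)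
    (W-number : kW ≡ suc s₁ ℕ.* suc (s₁ ℕ.* t₁))
    (V-number : kV ≡ suc t₁ ℕ.* suc (t₁ ℕ.* s₁)) where

  open import Data.Integer using (_+_; _*_; _-_; -_; _≤_)
  open Counting ax eP eL line-size point-size using (module Variance; N)
  open Variance l₀ W W-size

  private
    to-ℤ : ∀ {k} a b → k ≡ suc a ℕ.* suc (a ℕ.* b) → + k ≡ (1ℤ + + a) * (1ℤ + + a * + b)
    to-ℤ a b refl = trans (ℤ.pos-* (suc a) (suc (a ℕ.* b))) (cong (λ r → (1ℤ + + a) * (1ℤ + r)) (ℤ.pos-* a b))

    kW≡ : + kW ≡ (1ℤ + + s₁) * (1ℤ + + s₁ * + t₁)
    kW≡ = to-ℤ s₁ t₁ W-number

    kV≡ : + kV ≡ (1ℤ + + t₁) * (1ℤ + + t₁ * + s₁)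
    kV≡ = to-ℤ t₁ s₁ V-number

  u-V : ∀ l → V l ≡ true → u l ≡ 1ℤ + + s₁
  u-V l l∈V = trans (∑-cong eP (λ x → sym (⟦∧⟧ (inc x l) (W x)))) (∑-count eP (λ x → inc x l ∧ W x) (V-line l l∈V))

  u-other : ∀ l → V l ≢ true → u l ≡ 0ℤ ⊎ u l ≡ 1ℤ
  u-other l l∉V with search eP (λ x → (inc x l Bool.≟ true) ×-dec (W x Bool.≟ true))
  ... | no none = inj₁ (∑-zero eP (λ x → trans (sym (⟦∧⟧ (inc x l) (W x))) (cong ⟦_⟧ (off x (inc x l) (W x) refl refl))))
    where
    off : ∀ x b c → inc x l ≡ b → W x ≡ c → b ∧ c ≡ false
    off x true  true  p q = ⊥-elim (none (x , p , q))
    off x true  false p q = refl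
    off x false c     p q = refl
  ... | yes (y , y∈l , y∈W) = inj₂ (trans (∑-single eP y (λ x x≢y → trans (sym (⟦∧⟧ (inc x l) (W x))) (cong ⟦_⟧ (off x x≢y (inc x l) (W x) refl refl))))
                                          (cong₂ _*_ (cong ⟦_⟧ y∈l) (cong ⟦_⟧ y∈W)))
    where
    off : ∀ x → x ≢ y → ∀ b c → inc x l ≡ b → W x ≡ c → b ∧ c ≡ false
    off x x≢y true  true  p q = ⊥-elim (x≢y (other-line l∉V q y∈W p y∈l))
    off x x≢y true  false p q = refl
    off x x≢y false c     p q = refl

  -- Off V the value of u is 0 or 1, so u² - u vanishes there; on V it is the constant (1 + s₁)² -
  -- (1 + s₁).
  uu : ∀ l → u l * u l ≡ u l + (+ s₁ * (1ℤ + + s₁)) * ⟦ V l ⟧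
  uu l with V l in eq
  ... | true = trans (cong₂ _*_ (u-V l eq) (u-V l eq)) (trans (arith (+ s₁)) (cong (_+ (+ s₁ * (1ℤ + + s₁)) * 1ℤ) (sym (u-V l eq))))
    where
    arith : ∀ a → (1ℤ + a) * (1ℤ + a) ≡ 1ℤ + a + a * (1ℤ + a) * 1ℤ
    arith = solve-∀
  ... | false = trans (idem (u-other l (λ p → case (trans (sym eq) p)))) (arith (u l) (+ s₁))
    where
    case : false ≡ true → ⊥
    case ()
    idem : u l ≡ 0ℤ ⊎ u l ≡ 1ℤ → u l * u l ≡ u l
    idem (inj₁ p) = trans (cong₂ _*_ p p) (sym p)
    idem (inj₂ p) = trans (cong₂ _*_ p p) (sym p)
    arith : ∀ u a → u ≡ u + a * (1ℤ + a) * 0ℤ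
    arith = solve-∀

  q≡ : q ≡ (1ℤ + + t) * + kW + (+ s₁ * (1ℤ + + s₁)) * + kV
  q≡ = begin
    q                                                                       ≡⟨ ∑-cong eL uu ⟩
    ∑ eL (λ l → u l + (+ s₁ * (1ℤ + + s₁)) * ⟦ V l ⟧)                       ≡⟨ ∑-+ eL u (λ l → (+ s₁ * (1ℤ + + s₁)) * ⟦ V l ⟧) ⟩
    ∑ eL u + ∑ eL (λ l → (+ s₁ * (1ℤ + + s₁)) * ⟦ V l ⟧)
      ≡⟨ cong₂ _+_ ∑u (trans (∑-*ˡ eL (+ s₁ * (1ℤ + + s₁)) (λ l → ⟦ V l ⟧)) (cong ((+ s₁ * (1ℤ + + s₁)) *_) (∑-count eL V V-size))) ⟩
    (1ℤ + + t) * + kW + (+ s₁ * (1ℤ + + s₁)) * + kV                         ∎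
    where open ≡-Reasoning

  -- With `q` and the sizes of W and V expressed in s₁ and t₁, the value of ∑ f² factors completely.
  -- Only the last two factors can be negative or vanish together with s - s₁, whence the strict
  -- hypothesis in `order-bound`.
  order-product : 0ℤ ≤ (1ℤ + + s) * (+ s + + t) * ((1ℤ + + s₁) * (1ℤ + + s₁ * + t₁)) * ((+ s - + s₁) * (+ s - + s₁ * + t₁))
  order-product = subst (0ℤ ≤_)
    (trans (cong₂ (λ q r → (1ℤ + + s) * (+ s + + t) * ((1ℤ + + s) * ((+ s + + t) * r - q) + r * r))
                  (trans q≡ (cong₂ (λ r k → (1ℤ + + t) * r + (+ s₁ * (1ℤ + + s₁)) * k) kW≡ kV≡)) kW≡)
           (arith (+ s) (+ t) (+ s₁) (+ t₁)))
    variance-nonneg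
    where
    arith : ∀ s t a b →
      (1ℤ + s) * (s + t) * ((1ℤ + s) * ((s + t) * ((1ℤ + a) * (1ℤ + a * b)) - ((1ℤ + t) * ((1ℤ + a) * (1ℤ + a * b)) + (a * (1ℤ + a)) * ((1ℤ + b) * (1ℤ + b * a))))
        + (1ℤ + a) * (1ℤ + a * b) * ((1ℤ + a) * (1ℤ + a * b)))
      ≡ (1ℤ + s) * (s + t) * ((1ℤ + a) * (1ℤ + a * b)) * ((s - a) * (s - a * b))
    arith = solve-∀

  order-bound : s₁ ℕ.< s → s₁ ℕ.* t₁ ℕ.≤ s
  order-bound s₁<s = ℤ.drop‿+≤+ (subst (_≤ + s) (sym (ℤ.pos-* s₁ t₁)) (ℤ.0≤i-j⇒j≤i (cancel (+ s - + s₁) _ s-s₁>0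
      (cancel _ ((+ s - + s₁) * (+ s - + s₁ * + t₁)) scale>0 order-product))))
    where
    cancel : ∀ i j → 0ℤ ℤ.< i → 0ℤ ≤ i * j → 0ℤ ≤ j
    cancel i j i>0 h = ℤ.*-cancelˡ-≤-pos 0ℤ j i {{ℤ.positive i>0}} (subst (_≤ i * j) (sym (ℤ.*-zeroʳ i)) h)
    s-s₁>0 : 0ℤ ℤ.< + s - + s₁
    s-s₁>0 = subst (ℤ._< + s - + s₁) (ℤ.+-inverseʳ (+ s₁)) (ℤ.+-monoˡ-< (- (+ s₁)) (ℤ.+<+ s₁<s))
    prod>0 : ∀ {i j} → 0ℤ ℤ.< i → 0ℤ ℤ.< j → 0ℤ ℤ.< i * j
    prod>0 {i} {j} i>0 j>0 = subst (ℤ._< i * j) (ℤ.*-zeroʳ i) (ℤ.*-monoˡ-<-pos i {{ℤ.positive i>0}} j>0)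
    scale>0 : 0ℤ ℤ.< (1ℤ + + s) * (+ s + + t) * ((1ℤ + + s₁) * (1ℤ + + s₁ * + t₁))
    scale>0 = prod>0 {(1ℤ + + s) * (+ s + + t)} (prod>0 {1ℤ + + s} {+ s + + t} (ℤ.+<+ (ℕ.s≤s ℕ.z≤n)) (ℤ.+<+ (ℕ.≤-trans (ℕ.≤-trans (ℕ.s≤s ℕ.z≤n) s₁<s) (ℕ.m≤m+n s t))))
                     (subst (0ℤ ℤ.<_) (trans (cong +_ (sym W-number)) kW≡) (ℤ.+<+ (ℕ.s≤s ℕ.z≤n)))

-- From diameter and girth to the axioms, and back.

lookup-injective : {A : Set} {xs : List A} → Unique xs → ∀ {i j} → lookup xs i ≡ lookup xs j → i ≡ j
lookup-injective (_ ∷ _)  {zero}  {zero}  _ = refl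
lookup-injective (x≢ ∷ _) {zero}  {suc j} p = ⊥-elim (All.lookup x≢ (∈-lookup j) p)
lookup-injective (x≢ ∷ _) {suc i} {zero}  p = ⊥-elim (All.lookup x≢ (∈-lookup i) (sym p))
lookup-injective (_ ∷ u)  {suc i} {suc j} p = cong suc (lookup-injective u p)

module FromGQ {P L : Set} {inc : P → L → Bool} {s t : ℕ} (_≟ₚ_ : DecidableEquality P) (_≟ₗ_ : DecidableEquality L)
              (gq : IsGQ (mkInc P L inc) s t) where
  open IncidenceGraph (mkInc P L inc)

  private
    diameter = proj₁ gq
    girth = proj₁ (proj₂ gq)

    small : ∀ {k} → 8 ℕ.≤ k → k ℕ.≤ 6 → ⊥
    small p q with ℕ.≤-trans p q
    ... | ℕ.s≤s (ℕ.s≤s (ℕ.s≤s (ℕ.s≤s (ℕ.s≤s (ℕ.s≤s ())))))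

    p≢ : ∀ {x y : P} → x ≢ y → _≢_ {A = Vtx} (inj₁ x) (inj₁ y)
    p≢ x≢y = x≢y ∘ inj₁-injective

    l≢ : ∀ {l m : L} → l ≢ m → _≢_ {A = Vtx} (inj₂ l) (inj₂ m)
    l≢ l≢m = l≢m ∘ inj₂-injective

    no-digon : ∀ {x y l m} → x ≢ y → l ≢ m → inc x l ≡ true → inc y l ≡ true → inc x m ≡ true → inc y m ≡ true → ⊥
    no-digon {x} {y} {l} {m} x≢y l≢m a b c d = small (proj₂ girth 4 cycle) (ℕ.s≤s (ℕ.s≤s (ℕ.s≤s (ℕ.s≤s ℕ.z≤n))))
      where
      vs : List Vtx
      vs = inj₁ x ∷ inj₂ l ∷ inj₁ y ∷ inj₂ m ∷ []
      vs-unique : Unique vs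
      vs-unique = ((λ ()) ∷ p≢ x≢y ∷ (λ ()) ∷ []) ∷ ((λ ()) ∷ l≢ l≢m ∷ []) ∷ ((λ ()) ∷ []) ∷ [] ∷ []
      adj : (i : Fin 3) → Adj (lookup vs (Fin.inject₁ i)) (lookup vs (suc i))
      adj zero = a
      adj (suc zero) = b
      adj (suc (suc zero)) = d
      cycle : Cycle 4
      cycle = ℕ.s≤s (ℕ.s≤s (ℕ.s≤s ℕ.z≤n)) , lookup vs , lookup-injective vs-unique , adj , c

    no-triangle : ∀ {x y z l m n} → x ≢ y → y ≢ z → x ≢ z → l ≢ m → m ≢ n → l ≢ n →
                  inc x l ≡ true → inc y l ≡ true → inc y m ≡ true → inc z m ≡ true → inc z n ≡ true → inc x n ≡ true → ⊥
    no-triangle {x} {y} {z} {l} {m} {n} x≢y y≢z x≢z l≢m m≢n l≢n a b c d e f =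
      small (proj₂ girth 6 cycle) ℕ.≤-refl
      where
      vs : List Vtx
      vs = inj₁ x ∷ inj₂ l ∷ inj₁ y ∷ inj₂ m ∷ inj₁ z ∷ inj₂ n ∷ []
      vs-unique : Unique vs
      vs-unique = ((λ ()) ∷ p≢ x≢y ∷ (λ ()) ∷ p≢ x≢z ∷ (λ ()) ∷ []) ∷ ((λ ()) ∷ l≢ l≢m ∷ (λ ()) ∷ l≢ l≢n ∷ []) ∷
                  ((λ ()) ∷ p≢ y≢z ∷ (λ ()) ∷ []) ∷ ((λ ()) ∷ l≢ m≢n ∷ []) ∷ ((λ ()) ∷ []) ∷ [] ∷ []
      adj : (i : Fin 5) → Adj (lookup vs (Fin.inject₁ i)) (lookup vs (suc i))
      adj zero = a
      adj (suc zero) = b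
      adj (suc (suc zero)) = c
      adj (suc (suc (suc zero))) = d
      adj (suc (suc (suc (suc zero)))) = e
      cycle : Cycle 6
      cycle = ℕ.s≤s (ℕ.s≤s (ℕ.s≤s ℕ.z≤n)) , lookup vs , lookup-injective vs-unique , adj , f

    Projection : P → L → Set
    Projection x l = ∃[ y ] ∃[ m ] (inc x m ≡ true × inc y m ≡ true × inc y l ≡ true)

    -- A walk from a point to a line has odd length, hence length 1 or 3 within the diameter. Length
    -- 1 is incidence, and length 3 exhibits the projection.
    walk-projection : ∀ {x l k} → k ℕ.≤ 4 → inc x l ≢ true → Walk (inj₁ x) (inj₂ l) k → Projection x l
    walk-projection _ x∉l (step {v = inj₁ _} () _)
    walk-projection _ x∉l (step {v = inj₂ _} a here) = ⊥-elim (x∉l a)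
    walk-projection _ x∉l (step {v = inj₂ _} a (step {v = inj₂ _} () _))
    walk-projection _ x∉l (step {v = inj₂ m} a (step {v = inj₁ y} b (step {v = inj₂ _} c here))) = y , m , a , b , c
    walk-projection _ x∉l (step {v = inj₂ m} a (step {v = inj₁ y} b (step {v = inj₁ _} () _)))
    walk-projection _ x∉l (step {v = inj₂ m} a (step {v = inj₁ y} b (step {v = inj₂ _} c (step {v = inj₁ _} d (step {v = inj₁ _} () _)))))
    walk-projection _ x∉l (step {v = inj₂ m} a (step {v = inj₁ y} b (step {v = inj₂ _} c (step {v = inj₂ _} () _))))
    walk-projection (ℕ.s≤s (ℕ.s≤s (ℕ.s≤s (ℕ.s≤s ())))) x∉l (step {v = inj₂ m} a (step {v = inj₁ y} b (step {v = inj₂ _} c (step {v = inj₁ _} d (step {v = inj₂ _} _ _)))))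

  axioms : GQAxioms inc
  axioms = record { unique = unique ; project = project ; project-unique = project-unique }
    where
    unique : ∀ {x y l m} → inc x l ≡ true → inc y l ≡ true → inc x m ≡ true → inc y m ≡ true → x ≡ y ⊎ l ≡ m
    unique {x} {y} {l} {m} a b c d with x ≟ₚ y | l ≟ₗ m
    ... | yes p | _     = inj₁ p
    ... | no _  | yes q = inj₂ q
    ... | no p  | no q  = ⊥-elim (no-digon p q a b c d)
    project : ∀ x l → inc x l ≢ true → Projection x l
    project x l x∉l = let k , k≤4 , w = proj₁ diameter (inj₁ x) (inj₂ l) in walk-projection k≤4 x∉l w
    project-unique : ∀ {x l y m y′ m′} → inc x l ≢ true →
      inc x m ≡ true → inc y m ≡ true → inc y l ≡ true →
      inc x m′ ≡ true → inc y′ m′ ≡ true → inc y′ l ≡ true → y ≡ y′ × m ≡ m′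
    project-unique {x} {l} {y} {m} {y′} {m′} x∉l x∈m y∈m y∈l x∈m′ y′∈m′ y′∈l with y ≟ₚ y′
    ... | yes refl with unique x∈m y∈m x∈m′ y′∈m′
    ...   | inj₁ refl = ⊥-elim (x∉l y∈l)
    ...   | inj₂ q    = refl , q
    project-unique {x} {l} {y} {m} {y′} {m′} x∉l x∈m y∈m y∈l x∈m′ y′∈m′ y′∈l | no y≢y′ =
      ⊥-elim (no-triangle (λ { refl → x∉l y∈l }) y≢y′ (λ { refl → x∉l y′∈l })
                          (λ { refl → x∉l x∈m }) (λ { refl → x∉l x∈m′ }) m≢m′
                          x∈m y∈m y∈l y′∈l y′∈m′ x∈m′)
      where
      m≢m′ : m ≢ m′
      m≢m′ refl with unique y∈m y′∈m′ y∈l y′∈l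
      ... | inj₁ p = y≢y′ p
      ... | inj₂ refl = x∉l x∈m

-- The two hypotheses on further points and lines exclude degenerate models of the axioms, such as a
-- single line with all points on it.
module Incidence {P L : Set} {inc : P → L → Bool} (ax : GQAxioms inc)
    (other-point : ∀ l x → ∃[ y ] (y ≢ x × inc y l ≡ true))
    (other-line : ∀ x l → ∃[ m ] (m ≢ l × inc x m ≡ true)) where
  open GQAxioms ax
  open IncidenceGraph (mkInc P L inc)

  private
    walk-to-line : ∀ x l → ∃[ k ] (k ℕ.≤ 3 × Walk (inj₁ x) (inj₂ l) k)
    walk-to-line x l with inc x l Bool.≟ true
    ... | yes p = 1 , ℕ.s≤s ℕ.z≤n , step p here
    ... | no p  = let y , m , a , b , c = project x l p in
                  3 , ℕ.≤-refl , step {v = inj₂ m} a (step {v = inj₁ y} b (step c here))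

    walk-to-point : ∀ l x → ∃[ k ] (k ℕ.≤ 3 × Walk (inj₂ l) (inj₁ x) k)
    walk-to-point l x with inc x l Bool.≟ true
    ... | yes p = 1 , ℕ.s≤s ℕ.z≤n , step p here
    ... | no p  = let y , m , a , b , c = project x l p in
                  3 , ℕ.≤-refl , step {v = inj₁ y} c (step {v = inj₂ m} b (step a here))

    walk : P → L → ∀ u v → ∃[ k ] (k ℕ.≤ 4 × Walk u v k)
    walk _ l₀ (inj₁ x) (inj₁ y) =
      let l , _ , x∈l = other-line x l₀ ; k , k≤3 , w = walk-to-point l y in suc k , ℕ.s≤s k≤3 , step {v = inj₂ l} x∈l w
    walk _ _ (inj₁ x) (inj₂ l) = let k , k≤3 , w = walk-to-line x l in k , ℕ.m≤n⇒m≤1+n k≤3 , w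
    walk _ _ (inj₂ l) (inj₁ x) = let k , k≤3 , w = walk-to-point l x in k , ℕ.m≤n⇒m≤1+n k≤3 , w
    walk x₀ _ (inj₂ l) (inj₂ m) =
      let x , _ , x∈l = other-point l x₀ ; k , k≤3 , w = walk-to-line x m in suc k , ℕ.s≤s k≤3 , step {v = inj₁ x} x∈l w

    long-walk : ∀ {x z k} → x ≢ z → (∀ l → inc x l ≡ true → inc z l ≢ true) → Walk (inj₁ x) (inj₁ z) k → 4 ℕ.≤ k
    long-walk x≢z _ here = ⊥-elim (x≢z refl)
    long-walk _ _ (step {v = inj₁ _} () _)
    long-walk _ apart (step {v = inj₂ l} a (step {v = inj₁ _} b here)) = ⊥-elim (apart l a b)
    long-walk _ _ (step {v = inj₂ _} a (step {v = inj₂ _} () _))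
    long-walk _ _ (step {v = inj₂ _} a (step {v = inj₁ _} b (step {v = inj₁ _} () _)))
    long-walk _ _ (step {v = inj₂ _} a (step {v = inj₁ _} b (step {v = inj₂ _} c (step _ _)))) = ℕ.s≤s (ℕ.s≤s (ℕ.s≤s (ℕ.s≤s ℕ.z≤n)))

  -- A path x, l, y, m, z without backtracking ends at a point not collinear with x, so the distance
  -- 4 occurs. Projecting z to a second line k through x closes the path to an octagon.
  isGQ : P → L → (∀ k → Cycle k → 8 ℕ.≤ k) → {s t : ℕ} →
         (∀ l → HasSize (Σ P λ x → inc x l ≡ true) (suc s)) →
         (∀ x → HasSize (Σ L λ l → inc x l ≡ true) (suc t)) → IsGQ (mkInc P L inc) s t
  isGQ x l₀ girth line-size point-size with other-line x l₀
  ... | l , _ , x∈l with other-point l x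
  ... | y , y≢x , y∈l with other-line y l
  ... | m , m≢l , y∈m with other-point m y
  ... | z , z≢y , z∈m with other-line x l
  ... | k , k≢l , x∈k = (walk x l₀ , inj₁ x , inj₁ z , λ _ → long-walk x≢z apart) , (cycle , girth) , line-size , point-size
    where
    x∉m : inc x m ≢ true
    x∉m p = m≢l (unique-ln y≢x y∈m p y∈l x∈l)
    apart : ∀ n → inc x n ≡ true → inc z n ≢ true
    apart n x∈n z∈n = z≢y (sym (proj₁ (project-unique x∉m x∈l y∈l y∈m x∈n z∈n z∈m)))
    x≢z : x ≢ z
    x≢z refl = x∉m z∈m
    cycle : Cycle 8
    cycle with project z k (apart k x∈k)
    ... | w , n , z∈n , w∈n , w∈k = ℕ.s≤s (ℕ.s≤s (ℕ.s≤s ℕ.z≤n)) , lookup vs , lookup-injective vs-unique , adj , x∈k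
      where
      vs : List Vtx
      vs = inj₁ x ∷ inj₂ l ∷ inj₁ y ∷ inj₂ m ∷ inj₁ z ∷ inj₂ n ∷ inj₁ w ∷ inj₂ k ∷ []
      p≢ : ∀ {x y : P} → x ≢ y → _≢_ {A = Vtx} (inj₁ x) (inj₁ y)
      p≢ x≢y = x≢y ∘ inj₁-injective
      l≢ : ∀ {l m : L} → l ≢ m → _≢_ {A = Vtx} (inj₂ l) (inj₂ m)
      l≢ l≢m = l≢m ∘ inj₂-injective
      x≢w : x ≢ w
      x≢w refl = apart n w∈n z∈n
      y≢w : y ≢ w
      y≢w refl = k≢l (unique-ln y≢x w∈k x∈k y∈l x∈l)
      z≢w : z ≢ w
      z≢w refl = apart k x∈k w∈k
      l≢n : l ≢ n
      l≢n refl = apart n x∈l z∈n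
      m≢n : m ≢ n
      m≢n refl = y≢w (proj₁ (project-unique x∉m x∈l y∈l y∈m x∈k w∈k w∈n))
      m≢k : m ≢ k
      m≢k refl = x∉m x∈k
      n≢k : n ≢ k
      n≢k refl = apart n x∈k z∈n
      vs-unique : Unique vs
      vs-unique = ((λ ()) ∷ p≢ (y≢x ∘ sym) ∷ (λ ()) ∷ p≢ x≢z ∷ (λ ()) ∷ p≢ x≢w ∷ (λ ()) ∷ []) ∷
                  ((λ ()) ∷ l≢ (m≢l ∘ sym) ∷ (λ ()) ∷ l≢ l≢n ∷ (λ ()) ∷ l≢ (k≢l ∘ sym) ∷ []) ∷
                  ((λ ()) ∷ p≢ (z≢y ∘ sym) ∷ (λ ()) ∷ p≢ y≢w ∷ (λ ()) ∷ []) ∷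
                  ((λ ()) ∷ l≢ m≢n ∷ (λ ()) ∷ l≢ m≢k ∷ []) ∷
                  ((λ ()) ∷ p≢ z≢w ∷ (λ ()) ∷ []) ∷
                  ((λ ()) ∷ l≢ n≢k ∷ []) ∷ ((λ ()) ∷ []) ∷ [] ∷ []
      adj : (i : Fin 7) → Adj (lookup vs (Fin.inject₁ i)) (lookup vs (suc i))
      adj zero = x∈l
      adj (suc zero) = y∈l
      adj (suc (suc zero)) = y∈m
      adj (suc (suc (suc zero))) = z∈m
      adj (suc (suc (suc (suc zero)))) = z∈n
      adj (suc (suc (suc (suc (suc zero))))) = w∈n
      adj (suc (suc (suc (suc (suc (suc zero)))))) = w∈k

≡does : ∀ {b} {A : Set} (d : Dec A) → (b ≡ true → A) → (A → b ≡ true) → b ≡ does d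
≡does {true}  (yes _) f g = refl
≡does {true}  (no ¬a) f g = ⊥-elim (¬a (f refl))
≡does {false} (yes a) f g = g a
≡does {false} (no _)  f g = refl

-- Equality of line sizes.

module LineSizes {P L : Set} {inc : P → L → Bool} (ax : GQAxioms inc)
    {nP : ℕ} (eP : HasSize P nP) (_≟ₗ_ : DecidableEquality L)
    (size : ∀ l → ∃[ a ] HasSize (Σ P λ x → inc x l ≡ true) a) where
  open GQAxioms ax

  -- Projection from l to m is injective, because a point of l is recovered by projecting its image
  -- back to l.
  disjoint-≤ : ∀ l m → (∀ x → inc x l ≡ true → inc x m ≢ true) → proj₁ (size l) ℕ.≤ proj₁ (size m)
  disjoint-≤ l m apart = size-mono (proj₂ (size l)) (proj₂ (size m)) f f-injective
    where
    f : (Σ P λ x → inc x l ≡ true) → Σ P λ x → inc x m ≡ true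
    f (x , x∈l) = let y , _ , _ , _ , y∈m = project x m (apart x x∈l) in y , y∈m
    f-injective : ∀ {p p′} → f p ≡ f p′ → p ≡ p′
    f-injective {x , x∈l} {x′ , x′∈l} eq with project x m (apart x x∈l) | project x′ m (apart x′ x′∈l)
    ... | y , n , x∈n , y∈n , y∈m | y′ , n′ , x′∈n′ , y′∈n′ , y′∈m with cong proj₁ eq
    ... | refl = Σ≡ (proj₁ (project-unique (λ y∈l → apart y y∈l y∈m) y∈n x∈n x∈l y′∈n′ x′∈n′ x′∈l))

  -- Two concurrent lines have a common disjoint line once every point is on a third line.
  module _ (other-point : ∀ l x → ∃[ y ] (y ≢ x × inc y l ≡ true))
           (third-line : ∀ x l m → ∃[ k ] (k ≢ l × k ≢ m × inc x k ≡ true)) where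

    size-≤ : ∀ l m → proj₁ (size l) ℕ.≤ proj₁ (size m)
    size-≤ l m with search eP (λ x → (inc x l Bool.≟ true) ×-dec (inc x m Bool.≟ true))
    ... | no none = disjoint-≤ l m (λ x p q → none (x , p , q))
    -- The disjoint line is n, drawn through a point y other than x of a third line k through x. If
    -- n met l or m in w, then x, y and w would be a triangle.
    ... | yes (x , x∈l , x∈m) with third-line x l m
    ... | k , k≢l , k≢m , x∈k with other-point k x
    ... | y , y≢x , y∈k with third-line y k k
    ... | n , n≢k , _ , y∈n = ℕ.≤-trans (disjoint-≤ l n (λ w w∈l w∈n → apart w∈l w∈n x∈l k≢l))
                                       (disjoint-≤ n m (λ w w∈n w∈m → apart w∈m w∈n x∈m k≢m))
      where
      x∉n : inc x n ≢ true
      x∉n p = n≢k (unique-ln y≢x y∈n p y∈k x∈k)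
      apart : ∀ {w l} → inc w l ≡ true → inc w n ≡ true → inc x l ≡ true → k ≢ l → ⊥
      apart w∈l w∈n x∈l k≢l = k≢l (proj₂ (project-unique x∉n x∈k y∈k y∈n x∈l w∈l w∈n))

    size-≡ : ∀ l m → proj₁ (size l) ≡ proj₁ (size m)
    size-≡ l m = ℕ.≤-antisym (size-≤ l m) (size-≤ m l)

-- Two lines through every point: grids.

module TwoLines {P L : Set} {inc : P → L → Bool} (ax : GQAxioms inc)
    (other-line : ∀ x l → ∃[ m ] (m ≢ l × inc x m ≡ true))
    (two-lines : ∀ {x l m n} → l ≢ m → inc x l ≡ true → inc x m ≡ true → inc x n ≡ true → n ≡ l ⊎ n ≡ m) where
  open GQAxioms ax

  -- Coordinates along l: the lines crossing l are indexed by its points, and every point x lies on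
  -- exactly one of them, the one through the projection of x to l.
  module Side (l : L) where
    Points : Set
    Points = Σ P λ x → inc x l ≡ true

    cross : Points → L
    cross (a , _) = proj₁ (other-line a l)

    cross≢ : ∀ a → cross a ≢ l
    cross≢ (a , _) = proj₁ (proj₂ (other-line a l))

    on-cross : ∀ a → inc (proj₁ a) (cross a) ≡ true
    on-cross (a , _) = proj₂ (proj₂ (other-line a l))

    coord : P → Points
    coord x with inc x l Bool.≟ true
    ... | yes p = x , p
    ... | no p  = let y , _ , _ , _ , y∈l = project x l p in y , y∈l

    coord-cross : ∀ x a → inc x (cross a) ≡ true → coord x ≡ a
    coord-cross x a x∈ with inc x l Bool.≟ true
    ... | yes p = Σ≡ (unique-pt (cross≢ a) x∈ (on-cross a) p (proj₂ a))
    ... | no p with project x l p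
    ...   | y , m , x∈m , y∈m , y∈l = Σ≡ (proj₁ (project-unique p x∈m y∈m y∈l x∈ (on-cross a) (proj₂ a)))

    on-own-cross : ∀ x → inc x (cross (coord x)) ≡ true
    on-own-cross x with inc x l Bool.≟ true
    ... | yes p = on-cross (x , p)
    ... | no p with project x l p
    ...   | y , m , x∈m , y∈m , y∈l with two-lines (cross≢ (y , y∈l)) (on-cross (y , y∈l)) y∈l y∈m
    ...     | inj₁ refl = x∈m
    ...     | inj₂ refl = ⊥-elim (p x∈m)

    cross-coord : ∀ x a → coord x ≡ a → inc x (cross a) ≡ true
    cross-coord x _ refl = on-own-cross x

    cross-injective : ∀ {a b} → cross a ≡ cross b → a ≡ b
    cross-injective {a} {b} p = Σ≡ (unique-pt (cross≢ b) (subst (λ k → inc (proj₁ a) k ≡ true) p (on-cross a)) (on-cross b) (proj₂ a) (proj₂ b))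

    is-cross : ∀ {m} a → inc (proj₁ a) m ≡ true → m ≢ l → m ≡ cross a
    is-cross a a∈m m≢l with two-lines (cross≢ a) (on-cross a) (proj₂ a) a∈m
    ... | inj₁ p = p
    ... | inj₂ p = ⊥-elim (m≢l p)

  module _ {e : P} {l₁ l₂ : L} (l₁≢l₂ : l₁ ≢ l₂) (e∈l₁ : inc e l₁ ≡ true) (e∈l₂ : inc e l₂ ≡ true) where
    private
      module S₁ = Side l₁
      module S₂ = Side l₂

      -- A line crossing both l₁ and l₂ would complete a triangle with e, or else pass through e as
      -- a third line.
      cross-apart : ∀ a b → S₁.cross a ≢ S₂.cross b
      cross-apart a b p with inc e (S₁.cross a) Bool.≟ true
      ... | no e∉ = l₁≢l₂ (proj₂ (project-unique e∉ e∈l₁ (proj₂ a) (S₁.on-cross a) e∈l₂ (proj₂ b)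
                                    (subst (λ k → inc (proj₁ b) k ≡ true) (sym p) (S₂.on-cross b))))
      ... | yes e∈ with two-lines l₁≢l₂ e∈l₁ e∈l₂ e∈
      ...   | inj₁ q = S₁.cross≢ a q
      ...   | inj₂ q = S₂.cross≢ b (trans (sym p) q)

      line : S₁.Points ⊎ S₂.Points → L
      line (inj₁ a) = S₁.cross a
      line (inj₂ b) = S₂.cross b

      line-injective : ∀ {c d} → line c ≡ line d → c ≡ d
      line-injective {inj₁ a} {inj₁ a′} p = cong inj₁ (S₁.cross-injective p)
      line-injective {inj₁ a} {inj₂ b}  p = ⊥-elim (cross-apart a b p)
      line-injective {inj₂ b} {inj₁ a}  p = ⊥-elim (cross-apart a b (sym p))
      line-injective {inj₂ b} {inj₂ b′} p = cong inj₂ (S₂.cross-injective p)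

      line-surjective : ∀ m → ∃[ c ] line c ≡ m
      line-surjective m with inc e m Bool.≟ true
      ... | yes e∈m with two-lines l₁≢l₂ e∈l₁ e∈l₂ e∈m
      -- The sides are themselves crossing lines: l₁ crosses l₂ in e, and l₂ crosses l₁ in e.
      ...   | inj₁ refl = inj₂ (e , e∈l₂) , sym (S₂.is-cross (e , e∈l₂) e∈m l₁≢l₂)
      ...   | inj₂ refl = inj₁ (e , e∈l₁) , sym (S₁.is-cross (e , e∈l₁) e∈m (l₁≢l₂ ∘ sym))
      line-surjective m | no e∉m with project e m e∉m
      ... | y , k , e∈k , y∈k , y∈m with two-lines l₁≢l₂ e∈l₁ e∈l₂ e∈k
      ...   | inj₁ refl = inj₁ (y , y∈k) , sym (S₁.is-cross (y , y∈k) y∈m (λ { refl → e∉m e∈l₁ }))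
      ...   | inj₂ refl = inj₂ (y , y∈k) , sym (S₂.is-cross (y , y∈k) y∈m (λ { refl → e∉m e∈l₂ }))

      coords : P → S₁.Points × S₂.Points
      coords x = S₁.coord x , S₂.coord x

      coords-injective : ∀ {x y} → coords x ≡ coords y → x ≡ y
      coords-injective {x} {y} p = unique-pt (cross-apart (S₁.coord y) (S₂.coord y))
        (S₁.cross-coord x _ (cong proj₁ p)) (S₁.on-own-cross y) (S₂.cross-coord x _ (cong proj₂ p)) (S₂.on-own-cross y)

      crossing : ∀ a b → ∃[ x ] (inc x (S₁.cross a) ≡ true × inc x (S₂.cross b) ≡ true)
      crossing a b with inc (proj₁ b) (S₁.cross a) Bool.≟ true
      ... | yes p = proj₁ b , p , S₂.on-cross b
      ... | no p with project (proj₁ b) (S₁.cross a) p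
      ... | x , k , b∈k , x∈k , x∈ with two-lines (S₂.cross≢ b) (S₂.on-cross b) (proj₂ b) b∈k
      ... | inj₁ refl = x , x∈ , x∈k
      ... | inj₂ refl = ⊥-elim (cross-apart a (x , x∈k) (S₂.is-cross (x , x∈k) x∈ (λ q → p (subst (λ k → inc (proj₁ b) k ≡ true) (sym q) (proj₂ b)))))

      coords-surjective : ∀ c → ∃[ x ] coords x ≡ c
      coords-surjective (a , b) = let x , p , q = crossing a b in x , cong₂ _,_ (S₁.coord-cross x a p) (S₂.coord-cross x b q)

    grid : ∀ {s₁ s₂} → HasSize (Side.Points l₁) (suc s₁) → HasSize (Side.Points l₂) (suc s₂) → mkInc P L inc ≅ Grid s₁ s₂
    grid {s₁} {s₂} e₁ e₂ = α , β , λ x m → trans (cong (inc x) (sym (Inverse.strictlyInverseˡ line↔ m))) (incidence x (Inverse.from line↔ m))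
      where
      line↔ : (S₁.Points ⊎ S₂.Points) ↔ L
      line↔ = inj-surj⇒↔ line line-injective line-surjective
      α = (e₁ ×-↔ e₂) ↔-∘ inj-surj⇒↔ coords coords-injective coords-surjective
      β = (e₁ ⊎-↔ e₂) ↔-∘ ↔-sym line↔
      incidence : ∀ x c → inc x (line c) ≡ IncStr.inc (Grid s₁ s₂) (Inverse.to α x) (Inverse.to (e₁ ⊎-↔ e₂) c)
      incidence x (inj₁ a) = ≡does (Inverse.to e₁ (S₁.coord x) Fin.≟ Inverse.to e₁ a)
        (λ p → cong (Inverse.to e₁) (S₁.coord-cross x a p)) (λ p → S₁.cross-coord x a (↔-injective e₁ p))
      incidence x (inj₂ b) = ≡does (Inverse.to e₂ (S₂.coord x) Fin.≟ Inverse.to e₂ b)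
        (λ p → cong (Inverse.to e₂) (S₂.coord-cross x b p)) (λ p → S₂.cross-coord x b (↔-injective e₂ p))

-- Cosets of a subgroup and divisibility.

-- The least index satisfying p, provided that p holds at the fallback value d.
first : ∀ {n} → (Fin n → Bool) → Fin n → Fin n
first {suc n} p d with p zero | d
... | true  | _      = zero
... | false | zero   = zero
... | false | suc d′ = suc (first (p ∘ suc) d′)

first-true : ∀ {n} (p : Fin n → Bool) d → p d ≡ true → p (first p d) ≡ true
first-true {suc n} p d q with p zero in eq | d
... | true  | _      = eq
... | false | zero   with () ← trans (sym eq) q
... | false | suc d′ = first-true (p ∘ suc) d′ q

-- The fallback only witnesses that p is satisfiable. Elements of one coset enter with different
-- fallbacks and still receive the same representative.
first-cong : ∀ {n} {p p′ : Fin n → Bool} {d d′} → (∀ i → p i ≡ p′ i) → p d ≡ true → p′ d′ ≡ true → first p d ≡ first p′ d′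
first-cong {suc n} {p} {p′} {d} {d′} h q q′ with p zero in eq | p′ zero in eq′ | d | d′
... | true  | true  | _     | _      = refl
... | true  | false | _     | _      with () ← trans (sym eq) (trans (h zero) eq′)
... | false | true  | _     | _      with () ← trans (sym eq) (trans (h zero) eq′)
... | false | false | zero  | _      with () ← trans (sym eq) q
... | false | false | suc _ | zero   with () ← trans (sym eq′) q′
... | false | false | suc i | suc i′ = cong suc (first-cong (h ∘ suc) q q′)

Bool-ext : ∀ {a b} → (a ≡ true → b ≡ true) → (b ≡ true → a ≡ true) → a ≡ b
Bool-ext {true}  {b}     f g = sym (f refl)
Bool-ext {false} {true}  f g = g refl
Bool-ext {false} {false} f g = refl

toGroup : {G : Set} {_∙_ : G → G → G} {ε : G} {_⁻¹ : G → G} → IsGroup _≡_ _∙_ ε _⁻¹ → Group 0ℓ 0ℓ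
toGroup isGroup = record { isGroup = isGroup }

module Cosets {G : Set} {_∙_ : G → G → G} {ε : G} {_⁻¹ : G → G} (isGroup : IsGroup _≡_ _∙_ ε _⁻¹)
    {nG : ℕ} (eG : HasSize G nG)
    (Y : G → Bool) (ε∈Y : Y ε ≡ true)
    (∙∈Y : ∀ x y → Y x ≡ true → Y y ≡ true → Y (x ∙ y) ≡ true)
    (⁻¹∈Y : ∀ x → Y x ≡ true → Y (x ⁻¹) ≡ true) where
  open IsGroup isGroup using (inverseˡ; assoc)
  open GroupProperties (toGroup isGroup)
  open Inverse eG using (to; from; strictlyInverseʳ)

  same-coset : G → G → Bool
  same-coset x g = Y ((x ⁻¹) ∙ g)

  private
    self : ∀ x → same-coset x (from (to x)) ≡ true
    self x = trans (cong Y (trans (cong ((x ⁻¹) ∙_) (strictlyInverseʳ x)) (inverseˡ x))) ε∈Y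

  -- The canonical representative of the left coset x Y: its least element in the enumeration of G.
  rep : G → G
  rep x = from (first (same-coset x ∘ from) (to x))

  rep-coset : ∀ x → Y ((x ⁻¹) ∙ rep x) ≡ true
  rep-coset x = first-true (same-coset x ∘ from) (to x) (self x)

  rep-∙ : ∀ x y → Y y ≡ true → rep (x ∙ y) ≡ rep x
  rep-∙ x y y∈Y = cong from (first-cong (λ i → Bool-ext (left (from i)) (right (from i))) (self (x ∙ y)) (self x))
    where
    shift : ∀ g → ((x ∙ y) ⁻¹) ∙ g ≡ (y ⁻¹) ∙ ((x ⁻¹) ∙ g)
    shift g = trans (cong (_∙ g) (⁻¹-anti-homo-∙ x y)) (assoc (y ⁻¹) (x ⁻¹) g)
    left : ∀ g → same-coset (x ∙ y) g ≡ true → same-coset x g ≡ true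
    left g p = subst (λ z → Y z ≡ true) (trans (cong (y ∙_) (shift g)) (\\-leftDividesˡ y _)) (∙∈Y y _ y∈Y p)
    right : ∀ g → same-coset x g ≡ true → same-coset (x ∙ y) g ≡ true
    right g p = subst (λ z → Y z ≡ true) (sym (shift g)) (∙∈Y (y ⁻¹) _ (⁻¹∈Y y y∈Y) p)

  rep-inv : ∀ x → Y ((rep x ⁻¹) ∙ x) ≡ true
  rep-inv x = subst (λ z → Y z ≡ true)
    (trans (⁻¹-anti-homo-∙ (x ⁻¹) (rep x)) (cong ((rep x ⁻¹) ∙_) (⁻¹-involutive x))) (⁻¹∈Y _ (rep-coset x))

  -- A is a union of left cosets of Y, hence the product of Y with the set of representatives in A.
  -- In the applications A is the set of all points on a line stabilised by Y, which gives divisors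
  -- of s + 1.
  coset-divides : ∀ {m n} (A : G → Bool) → (∀ a y → A a ≡ true → Y y ≡ true → A (a ∙ y) ≡ true) →
                  HasSize (Σ G λ g → Y g ≡ true) m → HasSize (Σ G λ g → A g ≡ true) n → m ∣ n
  coset-divides {m} {n} A A-closed eY eA = divides (proj₁ reps) (size-unique eA (size-× (proj₂ reps) eY ↔-∘ mk↔ₛ′ split join split-join join-split))
    where
    Reps : Set
    Reps = Σ (Σ G λ g → A g ≡ true) λ a → rep (proj₁ a) ≡ proj₁ a
    reps : ∃[ k ] HasSize Reps k
    reps = subset-size eA (finite-≟ eG)
    rep∈A : ∀ a → A a ≡ true → A (rep a) ≡ true
    rep∈A a a∈A = subst (λ z → A z ≡ true) (\\-leftDividesˡ a (rep a)) (A-closed a _ a∈A (rep-coset a))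
    rep-rep : ∀ x → rep (rep x) ≡ rep x
    rep-rep x = trans (cong rep (sym (\\-leftDividesˡ x (rep x)))) (rep-∙ x _ (rep-coset x))
    split : (Σ G λ g → A g ≡ true) → Reps × (Σ G λ g → Y g ≡ true)
    split (a , a∈A) = ((rep a , rep∈A a a∈A) , rep-rep a) , ((rep a ⁻¹) ∙ a , rep-inv a)
    join : Reps × (Σ G λ g → Y g ≡ true) → Σ G λ g → A g ≡ true
    join (((b , b∈A) , _) , (y , y∈Y)) = b ∙ y , A-closed b y b∈A y∈Y
    split-join : ∀ c → split (join c) ≡ c
    split-join (((b , b∈A) , q) , (y , y∈Y)) = cong₂ _,_ (Σ≡ {g = proj₁} (Σ≡ r)) (Σ≡ (trans (cong (λ z → (z ⁻¹) ∙ (b ∙ y)) r) (\\-leftDividesʳ b y)))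
      where
      r : rep (b ∙ y) ≡ b
      r = trans (rep-∙ b y y∈Y) q
    join-split : ∀ a → join (split a) ≡ a
    join-split (a , _) = Σ≡ (\\-leftDividesˡ (rep a) a)

-- Finite sets with few elements.

does-size : {A B : Set} {n : ℕ} {f g : A → B} (_≟_ : DecidableEquality B) →
            HasSize (Σ A λ a → f a ≡ g a) n → HasSize (Σ A λ a → does (f a ≟ g a) ≡ true) n
does-size {f = f} {g} _≟_ e = e ↔-∘ mk↔ₛ′ (λ (a , q) → a , does⇒ (f a ≟ g a) q) (λ (a , q) → a , dec-true (f a ≟ g a) q)
                                   (λ _ → Σ≡ refl) (λ _ → Σ≡ refl)

two-elements : {A : Set} {n : ℕ} → HasSize A (suc (suc n)) → Σ A λ a → Σ A λ b → a ≢ b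
two-elements e = Inverse.from e zero , Inverse.from e (suc zero) , λ p → case (↔-injective (↔-sym e) p)
  where
  case : ∀ {n} → _≢_ {A = Fin (suc (suc n))} zero (suc zero)
  case ()

at-least-two : {A : Set} {k : ℕ} {a b : A} → a ≢ b → HasSize A k → ∃[ j ] k ≡ suc (suc j)
at-least-two {k = zero} {a} a≢b e with () ← Inverse.to e a
at-least-two {k = suc zero} a≢b e = ⊥-elim (a≢b (↔-injective e (fin₁ _ _)))
  where
  fin₁ : (i j : Fin 1) → i ≡ j
  fin₁ zero zero = refl
at-least-two {k = suc (suc j)} _ _ = j , refl

pair-size : {A : Set} → HasSize A 2 → {a b c : A} → a ≢ b → c ≡ a ⊎ c ≡ b
pair-size e {a} {b} {c} a≢b = Sum.map (↔-injective e) (↔-injective e) (fin₂ _ _ _ (a≢b ∘ ↔-injective e))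
  where
  fin₂ : (i j k : Fin 2) → i ≢ j → k ≡ i ⊎ k ≡ j
  fin₂ zero       zero       k          i≢j = ⊥-elim (i≢j refl)
  fin₂ (suc zero) (suc zero) k          i≢j = ⊥-elim (i≢j refl)
  fin₂ zero       (suc zero) zero       i≢j = inj₁ refl
  fin₂ zero       (suc zero) (suc zero) i≢j = inj₂ refl
  fin₂ (suc zero) zero       zero       i≢j = inj₂ refl
  fin₂ (suc zero) zero       (suc zero) i≢j = inj₁ refl

third-element : {A B : Set} {n : ℕ} → HasSize A (suc (suc (suc n))) → DecidableEquality B →
                (f : A → B) → Injective _≡_ _≡_ f → ∀ l m → ∃[ a ] (f a ≢ l × f a ≢ m)
third-element {A} e _≟_ f f-inj l m = choose a≢b a≢c b≢c
  where
  a b c : A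
  a = Inverse.from e zero
  b = Inverse.from e (suc zero)
  c = Inverse.from e (suc (suc zero))
  distinct : ∀ {i j} → i ≢ j → f (Inverse.from e i) ≢ f (Inverse.from e j)
  distinct i≢j p = i≢j (↔-injective (↔-sym e) (f-inj p))
  a≢b : f a ≢ f b
  a≢b = distinct (λ ())
  a≢c : f a ≢ f c
  a≢c = distinct (λ ())
  b≢c : f b ≢ f c
  b≢c = distinct (λ ())
  choose : f a ≢ f b → f a ≢ f c → f b ≢ f c → ∃[ a ] (f a ≢ l × f a ≢ m)
  choose a≢b a≢c b≢c with f a ≟ l | f a ≟ m | f b ≟ l | f b ≟ m
  ... | no p     | no q     | _        | _        = a , p , q
  ... | yes p    | _        | _        | no q     = b , (λ r → a≢b (trans p (sym r))) , q
  ... | yes p    | _        | _        | yes q    = c , (λ r → a≢c (trans p (sym r))) , (λ r → b≢c (trans q (sym r)))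
  ... | no _     | yes p    | no q     | _        = b , q , (λ r → a≢b (trans p (sym r)))
  ... | no _     | yes p    | yes q    | _        = c , (λ r → b≢c (trans q (sym r))) , (λ r → a≢c (trans p (sym r)))

-- The fixed substructure of a multiplier and the action of H.

module Multiplier (G : Set) (_∙_ : G → G → G) (ε : G) (_⁻¹ : G → G) (isGroup : IsGroup _≡_ _∙_ ε _⁻¹)
    (nG : ℕ) (eG : HasSize G nG) (L : Set) (nL : ℕ) (eL : HasSize L nL)
    (inc : G → L → Bool) (s t : ℕ) (2≤s : 2 ℕ.≤ s) (2≤t : 2 ℕ.≤ t) (gq : IsGQ (mkInc G L inc) s t)
    (translation : ∀ h → Σ (L → L) (λ ψ → IsAut inc (λ x → x ∙ h) ψ))
    (θ : G → G) (θ-aut : IsGroupAutomorphism G _∙_ ε _⁻¹ θ) (φ : L → L) (φ-aut : IsAut inc θ φ) where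

  open Setting G _∙_ ε _⁻¹ L inc s t θ φ
  open IsGroup isGroup using (assoc; identityˡ; identityʳ; inverseˡ; inverseʳ)
  open GroupProperties (toGroup isGroup)
  open GroupMorphisms.IsGroupIsomorphism θ-aut using (∙-homo; ε-homo; ⁻¹-homo; injective)

  infix 4 _≟ₚ_ _≟ₗ_
  _≟ₚ_ : DecidableEquality G
  _≟ₚ_ = finite-≟ eG

  _≟ₗ_ : DecidableEquality L
  _≟ₗ_ = finite-≟ eL

  abstract
    axioms : GQAxioms inc
    axioms = FromGQ.axioms _≟ₚ_ _≟ₗ_ gq

  open GQAxioms axioms

  line-size : ∀ l → HasSize (Σ G λ x → inc x l ≡ true) (suc s)
  line-size = proj₁ (proj₂ (proj₂ gq))

  point-size : ∀ x → HasSize (Σ L λ l → inc x l ≡ true) (suc t)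
  point-size = proj₂ (proj₂ (proj₂ gq))

  abstract
    -- Two points of l already determine the line, so one inclusion suffices. The line maps are
    -- supplied separately for each translation; this lemma turns them into an action of G on the
    -- lines.
    line-ext : ∀ {l m} → (∀ x → inc x l ≡ true → inc x m ≡ true) → l ≡ m
    line-ext {l} {m} l⊆m with subst (λ k → HasSize (Σ G λ x → inc x l ≡ true) (suc k)) (sym (proj₂ s-suc)) (line-size l)
      where
      s-suc : ∃[ k ] suc k ≡ s
      s-suc = ℕ.pred s , ℕ.suc-pred s {{ℕ.>-nonZero (ℕ.≤-trans (ℕ.s≤s ℕ.z≤n) 2≤s)}}
    ... | e with two-elements e
    ... | (x , x∈l) , (y , y∈l) , x≢y = unique-ln (λ p → x≢y (Σ≡ p)) x∈l y∈l (l⊆m x x∈l) (l⊆m y y∈l)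

  infixl 20 _·_
  _·_ : L → G → L
  l · h = proj₁ (translation h) l

  inc-∙ : ∀ x l h → inc x l ≡ inc (x ∙ h) (l · h)
  inc-∙ x l h = proj₂ (proj₂ (proj₂ (translation h))) x l

  inc-· : ∀ x l h → inc x (l · h) ≡ inc (x ∙ (h ⁻¹)) l
  inc-· x l h = trans (cong (λ z → inc z (l · h)) (sym (//-rightDividesˡ h x))) (sym (inc-∙ (x ∙ (h ⁻¹)) l h))

  ∙-on : ∀ {x l} h → inc x l ≡ true → inc (x ∙ h) (l · h) ≡ true
  ∙-on {x} {l} h p = trans (sym (inc-∙ x l h)) p

  ε-on : ∀ {l} h → inc ε l ≡ true → inc h (l · h) ≡ true
  ε-on {l} h p = subst (λ z → inc z (l · h) ≡ true) (identityˡ h) (∙-on h p)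

  abstract
    ·-∙ : ∀ l a b → l · a · b ≡ l · (a ∙ b)
    ·-∙ l a b = line-ext λ x p → trans (inc-· x l (a ∙ b))
      (trans (cong (λ z → inc z l) (trans (cong (x ∙_) (⁻¹-anti-homo-∙ a b)) (sym (assoc x (b ⁻¹) (a ⁻¹)))))
      (trans (sym (inc-· (x ∙ (b ⁻¹)) l a)) (trans (sym (inc-· x (l · a) b)) p)))

    ·-ε : ∀ l → l · ε ≡ l
    ·-ε l = line-ext λ x p → trans (cong (λ z → inc z l) (sym (trans (cong (x ∙_) ε⁻¹≈ε) (identityʳ x)))) (trans (sym (inc-· x l ε)) p)

    ·-⁻¹ʳ : ∀ l h → l · h · (h ⁻¹) ≡ l
    ·-⁻¹ʳ l h = trans (·-∙ l h (h ⁻¹)) (trans (cong (l ·_) (inverseʳ h)) (·-ε l))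

    ·-⁻¹ˡ : ∀ l h → l · (h ⁻¹) · h ≡ l
    ·-⁻¹ˡ l h = trans (·-∙ l (h ⁻¹) h) (trans (cong (l ·_) (inverseˡ h)) (·-ε l))

  ·-injective : ∀ {l m} h → l · h ≡ m · h → l ≡ m
  ·-injective {l} {m} h p = trans (sym (·-⁻¹ʳ l h)) (trans (cong (_· (h ⁻¹)) p) (·-⁻¹ʳ m h))

  ·-swap : ∀ {l m} h → l · h ≡ m → m · (h ⁻¹) ≡ l
  ·-swap {l} h refl = ·-⁻¹ʳ l h

  θ-on : ∀ {x l} → inc x l ≡ true → inc (θ x) (φ l) ≡ true
  θ-on {x} {l} p = trans (sym (proj₂ (proj₂ φ-aut) x l)) p

  θ-on-fixed : ∀ {x l} → φ l ≡ l → inc x l ≡ true → inc (θ x) l ≡ true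
  θ-on-fixed {x} φl≡l p = subst (λ k → inc (θ x) k ≡ true) φl≡l (θ-on p)

  φ-on-fixed : ∀ {x l} → InH x → inc x l ≡ true → inc x (φ l) ≡ true
  φ-on-fixed {x} {l} θx≡x p = subst (λ z → inc z (φ l) ≡ true) θx≡x (θ-on p)

  abstract
    H-ε : InH ε
    H-ε = ε-homo

    H-∙ : ∀ {x y} → InH x → InH y → InH (x ∙ y)
    H-∙ {x} {y} p q = trans (∙-homo x y) (cong₂ _∙_ p q)

    H-⁻¹ : ∀ {x} → InH x → InH (x ⁻¹)
    H-⁻¹ {x} p = trans (⁻¹-homo x) (cong _⁻¹ p)

    fixed-join : ∀ {x y l} → InH x → InH y → x ≢ y → inc x l ≡ true → inc y l ≡ true → φ l ≡ l
    fixed-join θx θy x≢y x∈l y∈l = unique-ln x≢y (φ-on-fixed θx x∈l) (φ-on-fixed θy y∈l) x∈l y∈l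

    fixed-meet : ∀ {x l m} → φ l ≡ l → φ m ≡ m → l ≢ m → inc x l ≡ true → inc x m ≡ true → InH x
    fixed-meet φl φm l≢m x∈l x∈m = unique-pt l≢m (θ-on-fixed φl x∈l) x∈l (θ-on-fixed φm x∈m) x∈m

    -- For h in H, `θ (x ∙ h)` equals `θ x ∙ h`: translation by h commutes with θ and so permutes
    -- the fixed lines.
    fixed-· : ∀ {l h} → φ l ≡ l → InH h → φ (l · h) ≡ l · h
    fixed-· {l} {h} φl θh = sym (line-ext λ x p → φ-θ x (trans (sym (inc-· x l h)) p))
      where
      φ-θ : ∀ x → inc (x ∙ (h ⁻¹)) l ≡ true → inc x (φ (l · h)) ≡ true
      φ-θ x p with proj₂ (proj₁ φ-aut) x
      -- The point x is written as `θ z`, since incidence with a line `φ (l · h)` is accessible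
      -- through images under θ.
      ... | z , θz = subst (λ w → inc w (φ (l · h)) ≡ true) (θz refl) (θ-on (trans (inc-· z l h) z∈))
        where
        z∈ : inc (z ∙ (h ⁻¹)) l ≡ true
        z∈ = trans (proj₂ (proj₂ φ-aut) (z ∙ (h ⁻¹)) l)
            (trans (cong₂ inc (trans (∙-homo z (h ⁻¹)) (cong₂ _∙_ (θz refl) (H-⁻¹ θh))) φl) p)

  inc₀ : H → L₀ → Bool
  inc₀ = IncStr.inc Sθ

  H≡ : {x y : H} → proj₁ x ≡ proj₁ y → x ≡ y
  H≡ = Σ≡ {f = θ} {g = λ x → x}

  L₀≡ : {l m : L₀} → proj₁ l ≡ proj₁ m → l ≡ m
  L₀≡ = Σ≡ {f = φ} {g = λ l → l}

  εᴴ : H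
  εᴴ = ε , H-ε

  _∙ᴴ_ : H → H → H
  (x , p) ∙ᴴ (y , q) = x ∙ y , H-∙ p q

  _⁻¹ᴴ : H → H
  (x , p) ⁻¹ᴴ = x ⁻¹ , H-⁻¹ p

  infixl 20 _·ᴴ_
  _·ᴴ_ : L₀ → H → L₀
  (l , p) ·ᴴ (h , q) = l · h , fixed-· p q

  abstract
    axioms₀ : GQAxioms inc₀
    axioms₀ = record
      { unique = λ a b c d → Sum.map H≡ L₀≡ (unique a b c d)
      ; project = λ x l x∉l → project₀ x l x∉l
      ; project-unique = λ x∉l a b c d e f → let p , q = project-unique x∉l a b c d e f in H≡ p , L₀≡ q
      }
      where
      project₀ : ∀ x l → inc₀ x l ≢ true → ∃[ y ] ∃[ m ] (inc₀ x m ≡ true × inc₀ y m ≡ true × inc₀ y l ≡ true)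
      project₀ (x , θx) (l , φl) x∉l with project x l x∉l
      -- The images `θ y` and `φ m` also project x to l, so uniqueness forces both y and m to be
      -- fixed.
      ... | y , m , x∈m , y∈m , y∈l with project-unique x∉l (φ-on-fixed θx x∈m) (θ-on y∈m) (θ-on-fixed φl y∈l) x∈m y∈m y∈l
      ... | θy , φm = (y , θy) , (m , φm) , x∈m , y∈m , y∈l

  module Graph = IncidenceGraph (mkInc G L inc)
  module Graph₀ = IncidenceGraph Sθ

  abstract
    girth₀ : ∀ k → Graph₀.Cycle k → 8 ℕ.≤ k
    girth₀ (suc m) (3≤ , c , c-inj , adj , closing) =
      proj₂ (proj₁ (proj₂ gq)) (suc m) (3≤ , embed ∘ c , c-inj ∘ embed-injective _ _ , (λ i → embed-adj _ _ (adj i)) , embed-adj _ _ closing)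
      where
      embed : Graph₀.Vtx → Graph.Vtx
      embed = Sum.map proj₁ proj₁
      embed-injective : ∀ u v → embed u ≡ embed v → u ≡ v
      embed-injective (inj₁ x) (inj₁ y) p = cong inj₁ (H≡ (inj₁-injective p))
      embed-injective (inj₂ l) (inj₂ m) p = cong inj₂ (L₀≡ (inj₂-injective p))
      embed-adj : ∀ u v → Graph₀.Adj u v → Graph.Adj (embed u) (embed v)
      embed-adj (inj₁ x) (inj₂ l) a = a
      embed-adj (inj₂ l) (inj₁ x) a = a

    H-size : ∃[ n ] HasSize H n
    H-size = subset-size eG _≟ₚ_

    L₀-size : ∃[ n ] HasSize L₀ n
    L₀-size = subset-size eL _≟ₗ_

  n n₀ : ℕ
  n = proj₁ H-size
  n₀ = proj₁ L₀-size

  eH : HasSize H n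
  eH = proj₂ H-size

  eL₀ : HasSize L₀ n₀
  eL₀ = proj₂ L₀-size

  isH : G → Bool
  isH g = does (θ g ≟ₚ g)

  isL₀ : L → Bool
  isL₀ l = does (φ l ≟ₗ l)

  isH-size : HasSize (Σ G λ g → isH g ≡ true) n
  isH-size = does-size _≟ₚ_ eH

  isL₀-size : HasSize (Σ L λ l → isL₀ l ≡ true) n₀
  isL₀-size = does-size _≟ₗ_ eL₀

  Points₀ : L₀ → Set
  Points₀ l = Σ H λ x → inc₀ x l ≡ true

  Lines₀ : H → Set
  Lines₀ x = Σ L₀ λ l → inc₀ x l ≡ true

  Lines₀-∙ : ∀ x → Lines₀ x ↔ Lines₀ εᴴ
  Lines₀-∙ x@(g , _) = mk↔ₛ′
    (λ (l , p) → l ·ᴴ (x ⁻¹ᴴ) , subst (λ z → inc z (proj₁ l · (g ⁻¹)) ≡ true) (inverseʳ g) (∙-on (g ⁻¹) p))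
    (λ (l , p) → l ·ᴴ x , ε-on g p)
    (λ (l , _) → Σ≡ (L₀≡ (·-⁻¹ʳ (proj₁ l) g)))
    (λ (l , _) → Σ≡ (L₀≡ (·-⁻¹ˡ (proj₁ l) g)))

  Points₀-· : ∀ l h → Points₀ (l ·ᴴ h) ↔ Points₀ l
  Points₀-· l h@(g , _) = mk↔ₛ′
    (λ (x , p) → x ∙ᴴ (h ⁻¹ᴴ) , trans (sym (inc-· (proj₁ x) (proj₁ l) g)) p)
    (λ (x , p) → x ∙ᴴ h , ∙-on g p)
    (λ (x , _) → Σ≡ (H≡ (//-rightDividesʳ g (proj₁ x))))
    (λ (x , _) → Σ≡ (H≡ (//-rightDividesˡ g (proj₁ x))))

  -- Cases (a) and (b).

  -- A line with two fixed points would be fixed. Hence the lines through distinct fixed points are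
  -- distinct, and |H| (t + 1) is at most the number (t + 1) (1 + s t) of all lines.
  caseA : (∀ l → φ l ≢ l) → CaseA
  caseA no-line = ((λ (l , φl) → no-line l φl) , apart) , n , eH , bound
    where
    apart : ∀ (x y : H) → proj₁ x ≢ proj₁ y → ¬ Collinear (proj₁ x) (proj₁ y)
    apart (x , θx) (y , θy) x≢y (l , x∈l , y∈l) = no-line l (fixed-join θx θy x≢y x∈l y∈l)
    line : H × Fin (suc t) → L
    line (x , i) = proj₁ (Inverse.from (point-size (proj₁ x)) i)
    line-injective : ∀ {p q} → line p ≡ line q → p ≡ q
    line-injective {x , i} {y , j} p with proj₁ x ≟ₚ proj₁ y
    ... | no x≢y = ⊥-elim (apart x y x≢y (line (x , i) , proj₂ (Inverse.from (point-size (proj₁ x)) i) ,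
                    subst (λ l → inc (proj₁ y) l ≡ true) (sym p) (proj₂ (Inverse.from (point-size (proj₁ y)) j))))
    ... | yes x≡y with H≡ {x} {y} x≡y
    ... | refl = cong (x ,_) (↔-injective (↔-sym (point-size (proj₁ x))) (Σ≡ p))
    nL≡ : nL ≡ suc t ℕ.* suc (t ℕ.* s)
    nL≡ = Counting.number-of-points (dual-axioms axioms) eL eG point-size line-size ε
    bound : n ℕ.≤ 1 ℕ.+ s ℕ.* t
    bound = subst (λ r → n ℕ.≤ suc r) (ℕ.*-comm t s) (ℕ.*-cancelʳ-≤ n (suc (t ℕ.* s)) (suc t)
      (ℕ.≤-trans (size-mono (size-× eH (Fin-size (suc t))) eL line line-injective)
                 (ℕ.≤-reflexive (trans nL≡ (ℕ.*-comm (suc t) (suc (t ℕ.* s)))))))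
      where
      Fin-size : ∀ k → HasSize (Fin k) k
      Fin-size k = mk↔ₛ′ (λ i → i) (λ i → i) (λ _ → refl) (λ _ → refl)

  -- For y in H, the line `l · y` contains `h ∙ y` and y, two distinct points of H and hence of l.
  -- So H stabilises l, and the points of l are a union of left cosets of H.
  caseB : ∀ {h} → InH h → h ≢ ε → (∃[ l ] ∀ (x : H) → inc (proj₁ x) l ≡ true) → CaseB
  caseB {h} θh h≢ε (l , H⊆l) = (l , H⊆l) , n , eH ,
    Cosets.coset-divides isGroup eG isH (dec-true (_ ≟ₚ _) H-ε)
      (λ x y p q → dec-true (_ ≟ₚ _) (H-∙ (does⇒ (_ ≟ₚ _) p) (does⇒ (_ ≟ₚ _) q)))
      (λ x p → dec-true (_ ≟ₚ _) (H-⁻¹ (does⇒ (_ ≟ₚ _) p)))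
      (λ g → inc g l) (λ a y a∈l y∈H → subst (λ k → inc (a ∙ y) k ≡ true) (stable (does⇒ (_ ≟ₚ _) y∈H)) (∙-on y a∈l))
      isH-size (line-size l)
    where
    stable : ∀ {y} → InH y → l · y ≡ l
    stable {y} θy = unique-ln (λ p → h≢ε (∙-cancelʳ y h ε p)) (∙-on y (H⊆l (h , θh))) (∙-on y (H⊆l εᴴ))
                             (H⊆l (_ , H-∙ θh θy)) (H⊆l (_ , H-∙ H-ε θy))

  -- Fixed substructures with a fixed line and no line containing all of H.

  module Nondegenerate (spread : ¬ (∃[ l ] ∀ (x : H) → inc (proj₁ x) l ≡ true)) (l* : L₀) where
    open GQAxioms axioms₀ using () renaming (project to project₀; project-unique to project-unique₀)

    abstract
      off-line : ∀ l → ∃[ y ] (inc₀ y l ≢ true)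
      off-line l = counterexample eH (λ x → inc₀ x l Bool.≟ true) (λ all → spread (proj₁ l , all))

      line-through : ∀ x → ∃[ l ] inc₀ x l ≡ true
      line-through x with inc₀ x l* Bool.≟ true
      ... | yes p = l* , p
      ... | no p  = let _ , m , x∈m , _ = project₀ x l* p in m , x∈m

      point-on : ∀ l → ∃[ x ] inc₀ x l ≡ true
      point-on l with inc₀ εᴴ l Bool.≟ true
      ... | yes p = εᴴ , p
      ... | no p  = let x , _ , _ , _ , x∈l = project₀ εᴴ l p in x , x∈l

      -- A point y off a fixed line a projects to a point z of a along a second line b, so z is on
      -- two fixed lines. Translation by z⁻¹ x carries them to two fixed lines through x, one of
      -- which differs from l.
      other-line : ∀ x l → ∃[ m ] (m ≢ l × inc₀ x m ≡ true)
      other-line x l with line-through εᴴ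
      ... | a , _ with off-line a
      ... | y , y∉a with project₀ y a y∉a
      ... | z , b , y∈b , z∈b , z∈a with proj₁ l ≟ₗ proj₁ (a ·ᴴ ((z ⁻¹ᴴ) ∙ᴴ x))
      ... | no l≢ = a ·ᴴ ((z ⁻¹ᴴ) ∙ᴴ x) , (λ p → l≢ (sym (cong proj₁ p))) ,
                    subst (λ w → inc w (proj₁ (a ·ᴴ ((z ⁻¹ᴴ) ∙ᴴ x))) ≡ true) (\\-leftDividesˡ (proj₁ z) (proj₁ x)) (∙-on _ z∈a)
      ... | yes l≡ = b ·ᴴ ((z ⁻¹ᴴ) ∙ᴴ x) , (λ p → y∉a (subst (λ k → inc (proj₁ y) k ≡ true) (·-injective _ (trans (cong proj₁ p) l≡)) y∈b)) ,
                    subst (λ w → inc w (proj₁ (b ·ᴴ ((z ⁻¹ᴴ) ∙ᴴ x))) ≡ true) (\\-leftDividesˡ (proj₁ z) (proj₁ x)) (∙-on _ z∈b)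

    -- If x were the only fixed point on l, every fixed point would be collinear with x, hence by transitivity with every other one.
    abstract
      other-point : ∀ l x → ∃[ y ] (y ≢ x × inc₀ y l ≡ true)
      other-point l x with search eH (λ y → ¬? (finite-≟ eH y x) ×-dec (inc₀ y l Bool.≟ true))
      ... | yes found = found
      ... | no none = ⊥-elim absurd
        where
        only : ∀ y → inc₀ y l ≡ true → y ≡ x
        only y y∈l with finite-≟ eH y x
        ... | yes p = p
        ... | no p  = ⊥-elim (none (y , p , y∈l))
        x∈l : inc₀ x l ≡ true
        x∈l with point-on l
        ... | y , y∈l = subst (λ z → inc₀ z l ≡ true) (only y y∈l) y∈l
        Joined : H → H → Set
        Joined u v = ∃[ m ] (inc₀ u m ≡ true × inc₀ v m ≡ true)
        to-x : ∀ y → Joined y x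
        to-x y with inc₀ y l Bool.≟ true
        ... | yes y∈l = l , y∈l , x∈l
        ... | no y∉l with project₀ y l y∉l
        ...   | z , m , y∈m , z∈m , z∈l = m , y∈m , subst (λ w → inc₀ w m ≡ true) (only z z∈l) z∈m
        joined : ∀ u v → Joined u v
        -- Translation by v⁻¹ x moves v to x, where collinearity is already known.
        joined u v with to-x (u ∙ᴴ ((v ⁻¹ᴴ) ∙ᴴ x))
        ... | m , u∈m , x∈m = m ·ᴴ (((v ⁻¹ᴴ) ∙ᴴ x) ⁻¹ᴴ) , back u u∈m , back v (subst (λ w → inc w (proj₁ m) ≡ true) (sym (\\-leftDividesˡ (proj₁ v) (proj₁ x))) x∈m)
          where
          back : ∀ w → inc₀ (w ∙ᴴ ((v ⁻¹ᴴ) ∙ᴴ x)) m ≡ true → inc₀ w (m ·ᴴ (((v ⁻¹ᴴ) ∙ᴴ x) ⁻¹ᴴ)) ≡ true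
          back w p = subst (λ z → inc z (proj₁ (m ·ᴴ (((v ⁻¹ᴴ) ∙ᴴ x) ⁻¹ᴴ))) ≡ true) (//-rightDividesʳ _ (proj₁ w)) (∙-on _ p)
        -- With all fixed points pairwise collinear, a point w off the line m joining x and y is
        -- collinear with both. Uniqueness of its projection to m gives x = y, although y was chosen
        -- off l.
        absurd : ⊥
        absurd with off-line l
        ... | y , y∉l with joined y x
        ... | m , y∈m , x∈m with off-line m
        ... | w , w∉m with joined w x | joined w y
        ... | k , w∈k , x∈k | k′ , w∈k′ , y∈k′ =
          y∉l (subst (λ z → inc₀ z l ≡ true) (proj₁ (project-unique₀ {w} {m} {x} {k} {y} {k′} w∉m w∈k x∈k x∈m w∈k′ y∈k′ y∈m)) x∈l)

    open Incidence axioms₀ other-point other-line using (isGQ)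

    sub-GQ : ∀ {s₁ t₁} → (∀ l → HasSize (Points₀ l) (suc s₁)) → (∀ x → HasSize (Lines₀ x) (suc t₁)) → IsGQ Sθ s₁ t₁
    sub-GQ = isGQ εᴴ l* girth₀

    sub-s≤s : ∀ {s₁} l → HasSize (Points₀ l) (suc s₁) → s₁ ℕ.≤ s
    sub-s≤s l e = ℕ.≤-pred (size-mono e (line-size (proj₁ l)) (λ (x , p) → proj₁ x , p) (λ p → Σ≡ (H≡ (cong proj₁ p))))

    sub-t≤t : ∀ {t₁} x → HasSize (Lines₀ x) (suc t₁) → t₁ ℕ.≤ t
    sub-t≤t x e = ℕ.≤-pred (size-mono e (point-size (proj₁ x)) (λ (l , p) → proj₁ l , p) (λ p → Σ≡ (L₀≡ (cong proj₁ p))))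

    module _ {s₁ t₁ : ℕ} (line-size₀ : ∀ l → HasSize (Points₀ l) (suc s₁)) (point-size₀ : ∀ x → HasSize (Lines₀ x) (suc t₁)) where
      private
        points≡ : n ≡ suc s₁ ℕ.* suc (s₁ ℕ.* t₁)
        points≡ = Counting.number-of-points axioms₀ eH eL₀ line-size₀ point-size₀ l*

        lines≡ : n₀ ≡ suc t₁ ℕ.* suc (t₁ ℕ.* s₁)
        lines≡ = Counting.number-of-points (dual-axioms axioms₀) eL₀ eH point-size₀ line-size₀ εᴴ

        fixed-points : ∀ l → isL₀ l ≡ true → HasSize (Σ G λ x → inc x l ∧ isH x ≡ true) (suc s₁)
        fixed-points l p = line-size₀ (l , does⇒ (_ ≟ₗ _) p) ↔-∘ mk↔ₛ′
          (λ (x , q) → (x , does⇒ (_ ≟ₚ _) (Bool.∧-conicalʳ (inc x l) _ q)) , Bool.∧-conicalˡ (inc x l) _ q)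
          (λ ((x , θx) , x∈l) → x , cong₂ _∧_ x∈l (dec-true (_ ≟ₚ _) θx))
          (λ _ → Σ≡ (H≡ refl)) (λ _ → Σ≡ refl)

        fixed-lines : ∀ x → isH x ≡ true → HasSize (Σ L λ l → inc x l ∧ isL₀ l ≡ true) (suc t₁)
        fixed-lines x p = point-size₀ (x , does⇒ (_ ≟ₚ _) p) ↔-∘ mk↔ₛ′
          (λ (l , q) → (l , does⇒ (_ ≟ₗ _) (Bool.∧-conicalʳ (inc x l) _ q)) , Bool.∧-conicalˡ (inc x l) _ q)
          (λ ((l , φl) , x∈l) → l , cong₂ _∧_ x∈l (dec-true (_ ≟ₗ _) φl))
          (λ _ → Σ≡ (L₀≡ refl)) (λ _ → Σ≡ refl)

      sub-bound : s₁ ℕ.< s → s₁ ℕ.* t₁ ℕ.≤ s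
      sub-bound = Subquadrangle.order-bound axioms eG eL line-size point-size (proj₁ l*) isH isL₀ isH-size isL₀-size
        fixed-points other points≡ lines≡
        where
        other : ∀ {l x y} → isL₀ l ≢ true → isH x ≡ true → isH y ≡ true → inc x l ≡ true → inc y l ≡ true → x ≡ y
        other {l} {x} {y} l∉ p q x∈l y∈l with x ≟ₚ y
        ... | yes x≡y = x≡y
        ... | no x≢y  = ⊥-elim (l∉ (dec-true (_ ≟ₗ _) (fixed-join (does⇒ (_ ≟ₚ _) p) (does⇒ (_ ≟ₚ _) q) x≢y x∈l y∈l)))

      sub-bound-dual : t₁ ℕ.< t → t₁ ℕ.* s₁ ℕ.≤ t
      sub-bound-dual = Subquadrangle.order-bound (dual-axioms axioms) eL eG point-size line-size ε isL₀ isH isL₀-size isH-size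
        fixed-lines other lines≡ points≡
        where
        other : ∀ {x l m} → isH x ≢ true → isL₀ l ≡ true → isL₀ m ≡ true → inc x l ≡ true → inc x m ≡ true → l ≡ m
        other {x} {l} {m} x∉ p q x∈l x∈m with l ≟ₗ m
        ... | yes l≡m = l≡m
        ... | no l≢m  = ⊥-elim (x∉ (dec-true (_ ≟ₚ _) (fixed-meet (does⇒ (_ ≟ₗ _) p) (does⇒ (_ ≟ₗ _) q) l≢m x∈l x∈m)))

    Points₀-size : ∀ l → ∃[ a ] HasSize (Points₀ l) (suc (suc a))
    Points₀-size l = let x , x∈l = point-on l ; y , y≢x , y∈l = other-point l x ; k , e = subset-size eH Bool._≟_
                         j , k≡ = at-least-two {a = y , y∈l} {x , x∈l} (λ p → y≢x (cong proj₁ p)) e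
                     in j , subst (HasSize (Points₀ l)) k≡ e

    -- Case (d): two fixed points on every fixed line.

    module Dual {t₁ : ℕ} (2≤t₁ : 2 ℕ.≤ t₁) (line-size₀ : ∀ l → HasSize (Points₀ l) 2) (point-size₀ : ∀ x → HasSize (Lines₀ x) (suc t₁)) where

      collinear? : ∀ x y → Dec (Collinear x y)
      collinear? x y = search eL (λ l → (inc x l Bool.≟ true) ×-dec (inc y l Bool.≟ true))

      -- Among the fixed points, which form a dual grid here, this is the relation of lying in the
      -- same class. It is an equivalence relation invariant under translations, so the class K of 1
      -- is a subgroup.
      Apart : G → G → Set
      Apart x y = x ≡ y ⊎ ¬ Collinear x y

      apart? : ∀ x y → Dec (Apart x y)
      apart? x y = (x ≟ₚ y) ⊎-dec ¬? (collinear? x y)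

      apart-sym : ∀ {x y} → Apart x y → Apart y x
      apart-sym = Sum.map sym (λ ¬c (l , a , b) → ¬c (l , b , a))

      apart-∙ : ∀ {x y} h → Apart x y → Apart (x ∙ h) (y ∙ h)
      apart-∙ h (inj₁ refl) = inj₁ refl
      apart-∙ {x} {y} h (inj₂ ¬c) = inj₂ λ (l , a , b) → ¬c (l · (h ⁻¹) , back x a , back y b)
        where
        back : ∀ z {l} → inc (z ∙ h) l ≡ true → inc z (l · (h ⁻¹)) ≡ true
        back z {l} p = subst (λ w → inc w (l · (h ⁻¹)) ≡ true) (//-rightDividesʳ h z) (∙-on (h ⁻¹) p)

      two-points : ∀ {x y z l} → InH x → InH y → InH z → x ≢ y → inc x l ≡ true → inc y l ≡ true → inc z l ≡ true → z ≡ x ⊎ z ≡ y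
      two-points {x} {y} {z} {l} θx θy θz x≢y x∈l y∈l z∈l =
        Sum.map (cong (proj₁ ∘ proj₁)) (cong (proj₁ ∘ proj₁))
          (pair-size (line-size₀ (l , fixed-join θx θy x≢y x∈l y∈l)) {(x , θx) , x∈l} {(y , θy) , y∈l} {(z , θz) , z∈l} (λ p → x≢y (cong (proj₁ ∘ proj₁) p)))

      -- If x and z were on a line, x and z would be its only fixed points. The projection of y
      -- would be one of them, and y would be collinear with it.
      apart-trans : ∀ {x y z} → InH x → InH y → InH z → Apart x y → Apart y z → Apart x z
      apart-trans θx θy θz (inj₁ refl) q = q
      apart-trans θx θy θz (inj₂ p) (inj₁ refl) = inj₂ p
      apart-trans {x} {y} {z} θx θy θz (inj₂ p) (inj₂ q) with x ≟ₚ z | collinear? x z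
      ... | yes x≡z | _      = inj₁ x≡z
      ... | no _    | no ¬c  = inj₂ ¬c
      ... | no x≢z  | yes (l , x∈l , z∈l) = ⊥-elim absurd
        where
        y∉l : inc y l ≢ true
        y∉l y∈l = p (l , x∈l , y∈l)
        absurd : ⊥
        absurd with project₀ (y , θy) (l , fixed-join θx θz x≢z x∈l z∈l) y∉l
        ... | (w , θw) , (m , _) , y∈m , w∈m , w∈l with two-points θx θz θw x≢z x∈l z∈l w∈l
        ... | inj₁ refl = p (m , w∈m , y∈m)
        ... | inj₂ refl = q (m , y∈m , w∈m)

      in-K? : ∀ g → Dec (InH g × Apart g ε)
      in-K? g = (θ g ≟ₚ g) ×-dec apart? g ε

      abstract
        K : G → Bool
        K g = does (in-K? g)

        K-intro : ∀ {g} → InH g → Apart g ε → K g ≡ true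
        K-intro {g} p q = dec-true (in-K? g) (p , q)

        K-elim : ∀ {g} → K g ≡ true → InH g × Apart g ε
        K-elim {g} = does⇒ (in-K? g)

      K-∙ : ∀ x y → K x ≡ true → K y ≡ true → K (x ∙ y) ≡ true
      K-∙ x y x∈K y∈K = let θx , p = K-elim x∈K ; θy , q = K-elim y∈K in
        K-intro (H-∙ θx θy) (apart-trans (H-∙ θx θy) θy H-ε (subst (Apart (x ∙ y)) (identityˡ y) (apart-∙ y p)) q)

      K-⁻¹ : ∀ x → K x ≡ true → K (x ⁻¹) ≡ true
      K-⁻¹ x x∈K = let θx , p = K-elim x∈K in
        K-intro (H-⁻¹ θx) (apart-sym (subst₂ Apart (inverseʳ x) (identityˡ (x ⁻¹)) (apart-∙ (x ⁻¹) p)))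

      K-subgroup : IsSubgroupOfH K
      K-subgroup = record
        { ⊆H = λ g p → proj₁ (K-elim p) ; ε∈ = K-intro H-ε (inj₁ refl) ; ∙∈ = K-∙ ; ⁻¹∈ = K-⁻¹ }

      K-noncollinear : ∀ x y → K x ≡ true → K y ≡ true → x ≢ y → ¬ Collinear x y
      K-noncollinear x y x∈K y∈K x≢y with K-elim x∈K | K-elim y∈K
      ... | θx , p | θy , q with apart-trans θx H-ε θy p (apart-sym q)
      ... | inj₁ x≡y = ⊥-elim (x≢y x≡y)
      ... | inj₂ ¬c  = ¬c

      -- For a fixed point a collinear with 1, the two cosets of K in H are K and K a.
      cosets : ∃[ k ] (HasSize (Elems K) k × n ≡ 2 ℕ.* k)
      cosets with line-through εᴴ
      ... | (l , φl) , ε∈l with other-point (l , φl) εᴴ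
      ... | (a , θa) , a≢ , a∈l = k , eK , trans (size-unique (eH ↔-∘ split) (size-⊎ eK eK)) (cong (k ℕ.+_) (sym (ℕ.+-identityʳ k)))
        where
        k = proj₁ (subset-size {f = K} {g = λ _ → true} eG Bool._≟_)
        eK = proj₂ (subset-size {f = K} {g = λ _ → true} eG Bool._≟_)
        a≢ε : a ≢ ε
        a≢ε p = a≢ (H≡ p)
        a∉K : K a ≢ true
        a∉K p with K-elim p
        ... | _ , inj₁ a≡ε = a≢ε a≡ε
        ... | _ , inj₂ ¬c  = ¬c (l , a∈l , ε∈l)
        coset : Elems K ⊎ Elems K → H
        coset (inj₁ (x , x∈K)) = x , proj₁ (K-elim x∈K)
        coset (inj₂ (x , x∈K)) = x ∙ a , H-∙ (proj₁ (K-elim x∈K)) θa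
        crossed : ∀ {x y} → K x ≡ true → K y ≡ true → x ≢ y ∙ a
        crossed {x} {y} x∈K y∈K p = a∉K (subst (λ z → K z ≡ true) (trans (cong ((y ⁻¹) ∙_) p) (\\-leftDividesʳ y a)) (K-∙ _ _ (K-⁻¹ y y∈K) x∈K))
        coset-injective : ∀ {c d} → coset c ≡ coset d → c ≡ d
        coset-injective {inj₁ _} {inj₁ _} p = cong inj₁ (Σ≡ (cong proj₁ p))
        coset-injective {inj₂ (x , _)} {inj₂ (y , _)} p = cong inj₂ (Σ≡ (∙-cancelʳ a x y (cong proj₁ p)))
        coset-injective {inj₁ (_ , x∈K)} {inj₂ (_ , y∈K)} p = ⊥-elim (crossed x∈K y∈K (cong proj₁ p))
        coset-injective {inj₂ (_ , x∈K)} {inj₁ (_ , y∈K)} p = ⊥-elim (crossed y∈K x∈K (sym (cong proj₁ p)))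
        -- Two points collinear with 1 are not collinear with each other, as lines carry two fixed points only.
        apart-a : ∀ {h} → InH h → ¬ Apart h ε → Apart h a
        apart-a {h} θh ¬p with h ≟ₚ a | collinear? h a | collinear? h ε
        ... | yes h≡a | _     | _     = inj₁ h≡a
        ... | no _    | no ¬c | _     = inj₂ ¬c
        ... | no _    | yes _ | no ¬d = ⊥-elim (¬p (inj₂ ¬d))
        ... | no h≢a  | yes (m , h∈m , a∈m) | yes (m′ , h∈m′ , ε∈m′) with inc ε m Bool.≟ true
        ...   | yes ε∈m with two-points H-ε θa θh (a≢ε ∘ sym) ε∈m a∈m h∈m
        ...     | inj₁ h≡ε = ⊥-elim (¬p (inj₁ h≡ε))
        ...     | inj₂ h≡a = ⊥-elim (h≢a h≡a)
        apart-a {h} θh ¬p | no h≢a | yes (m , h∈m , a∈m) | yes (m′ , h∈m′ , ε∈m′) | no ε∉m =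
          ⊥-elim (h≢a (proj₁ (project-unique ε∉m ε∈m′ h∈m′ h∈m ε∈l a∈l a∈m)))
        coset-surjective : ∀ h → ∃[ c ] coset c ≡ h
        coset-surjective (h , θh) with apart? h ε
        ... | yes p = inj₁ (h , K-intro θh p) , H≡ refl
        ... | no ¬p = inj₂ (h ∙ (a ⁻¹) , K-intro (H-∙ θh (H-⁻¹ θa)) (subst (Apart (h ∙ (a ⁻¹))) (inverseʳ a) (apart-∙ (a ⁻¹) (apart-a θh ¬p)))) ,
                      H≡ (//-rightDividesˡ a h)
        split : (Elems K ⊎ Elems K) ↔ H
        split = inj-surj⇒↔ coset coset-injective coset-surjective

      caseD : CaseD
      caseD = t₁ , sub-GQ line-size₀ point-size₀ , 2≤t₁ ,
        -- The inequality with s₁ = 1 gives the bound by s, and 1 < s is thickness; the bound by t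
        -- counts the lines through 1.
        ℕ.⊓-glb (subst (ℕ._≤ s) (ℕ.*-identityˡ t₁) (sub-bound line-size₀ point-size₀ 2≤s)) (sub-t≤t εᴴ (point-size₀ εᴴ)) ,
        K , K-subgroup , n , proj₁ cosets , (eH , proj₂ cosets) , K-noncollinear

    many-lines : ∀ {k} → HasSize (Lines₀ εᴴ) (suc (suc (suc k))) → CaseD ⊎ CaseE
    many-lines {k} e = by-size (proj₁ (Points₀-size l*)) line-size₀
      where
      point-size₀ : ∀ x → HasSize (Lines₀ x) (suc (suc (suc k)))
      point-size₀ x = e ↔-∘ Lines₀-∙ x
      sizes : ∀ l → ∃[ a ] HasSize (Points₀ l) a
      sizes l = let a , e′ = Points₀-size l in suc (suc a) , e′
      third-line : ∀ x l m → ∃[ k ] (k ≢ l × k ≢ m × inc₀ x k ≡ true)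
      third-line x l m = let (k , x∈k) , p , q = third-element (point-size₀ x) (finite-≟ eL₀) proj₁ Σ≡ l m in k , p , q , x∈k
      line-size₀ : ∀ l → HasSize (Points₀ l) (suc (suc (proj₁ (Points₀-size l*))))
      line-size₀ l = subst (HasSize (Points₀ l)) (LineSizes.size-≡ axioms₀ eH (finite-≟ eL₀) sizes other-point third-line l l*) (proj₂ (sizes l))
      by-size : ∀ a → (∀ l → HasSize (Points₀ l) (suc (suc a))) → CaseD ⊎ CaseE
      by-size zero    line-size₀ = inj₁ (Dual.caseD (ℕ.s≤s (ℕ.s≤s ℕ.z≤n)) line-size₀ point-size₀)
      by-size (suc a) line-size₀ = inj₂ (suc (suc a) , suc (suc k) , sub-GQ line-size₀ point-size₀ ,
                                         ℕ.s≤s (ℕ.s≤s ℕ.z≤n) , ℕ.s≤s (ℕ.s≤s ℕ.z≤n))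

    -- Cases (c) and (c'): two fixed lines through every fixed point.

    module TwoFixedLines (e : HasSize (Lines₀ εᴴ) 2) where
      point-size₀ : ∀ x → HasSize (Lines₀ x) 2
      point-size₀ x = e ↔-∘ Lines₀-∙ x

      two-lines : ∀ {x l m k} → l ≢ m → inc₀ x l ≡ true → inc₀ x m ≡ true → inc₀ x k ≡ true → k ≡ l ⊎ k ≡ m
      two-lines {x} {l} {m} {k} l≢m p q r = Sum.map (cong proj₁) (cong proj₁)
        (pair-size (point-size₀ x) {l , p} {m , q} {k , r} (λ eq → l≢m (cong proj₁ eq)))

      module _ {L₁ L₂ : L₀} (L₁≢L₂ : L₁ ≢ L₂) (ε∈L₁ : inc₀ εᴴ L₁ ≡ true) (ε∈L₂ : inc₀ εᴴ L₂ ≡ true) where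
        l₁ l₂ : L
        l₁ = proj₁ L₁
        l₂ = proj₁ L₂

        l₁≢l₂ : l₁ ≢ l₂
        l₁≢l₂ p = L₁≢L₂ (L₀≡ p)

        -- Translation by h carries the two fixed lines through 1 to two distinct fixed lines
        -- through h, and there are no others.
        lines-at : ∀ {h m} → InH h → φ m ≡ m → inc h m ≡ true → m ≡ l₁ · h ⊎ m ≡ l₂ · h
        lines-at {h} {m} θh φm h∈m = Sum.map (cong proj₁) (cong proj₁)
          (two-lines {h , θh} {L₁ ·ᴴ (h , θh)} {L₂ ·ᴴ (h , θh)} {m , φm}
            (λ p → l₁≢l₂ (·-injective h (cong proj₁ p))) (ε-on h ε∈L₁) (ε-on h ε∈L₂) h∈m)

        -- Projecting h to l₂ writes it as (h y⁻¹) y with y on l₂ and h y⁻¹ on l₁ or on l₂.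
        factor : ∀ {h} → InH h → inc h l₂ ≡ true ⊎
          (∃[ y ] (InH y × inc y l₂ ≡ true × l₂ · y ≢ l₂ × inc (h ∙ (y ⁻¹)) l₂ ≡ true))
          ⊎ (∃[ y ] (InH y × inc y l₂ ≡ true × inc (h ∙ (y ⁻¹)) l₁ ≡ true))
        factor {h} θh with inc h l₂ Bool.≟ true
        ... | yes h∈l₂ = inj₁ h∈l₂
        ... | no h∉l₂ with project₀ (h , θh) L₂ h∉l₂
        ... | (y , θy) , (m , φm) , h∈m , y∈m , y∈l₂ with lines-at θy φm y∈m
        ... | inj₁ refl = inj₂ (inj₂ (y , θy , y∈l₂ , trans (sym (inc-· h l₁ y)) h∈m))
        ... | inj₂ refl = inj₂ (inj₁ (y , θy , y∈l₂ , (λ p → h∉l₂ (subst (λ k → inc h k ≡ true) p h∈m)) , trans (sym (inc-· h l₂ y)) h∈m))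

        Stable : L → Set
        Stable l = ∀ {h} → InH h → inc h l ≡ true → l · h ≡ l

        module _ (stable₁ : Stable l₁) where
          -- A point h of l₂ that moves l₂ satisfies `l₂ ≡ l₁ · h`. Then h⁻¹ takes l₂ to l₁ and is a
          -- point of l₁, so it also stabilises l₁, which forces l₁ and l₂ to coincide.
          stable₂ : Stable l₂
          stable₂ {h} θh h∈l₂ with lines-at θh (proj₂ L₂) h∈l₂
          ... | inj₂ p = sym p
          ... | inj₁ p = ⊥-elim (l₁≢l₂ (·-injective (h ⁻¹) (trans (stable₁ (H-⁻¹ θh) h⁻¹∈l₁) (sym q))))
            where
            q : l₂ · (h ⁻¹) ≡ l₁
            q = ·-swap h (sym p)
            h⁻¹∈l₁ : inc (h ⁻¹) l₁ ≡ true
            h⁻¹∈l₁ = subst (λ k → inc (h ⁻¹) k ≡ true) q (ε-on (h ⁻¹) ε∈L₂)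

          abstract
            Y : L → G → Bool
            Y l g = isH g ∧ inc g l

            Y-intro : ∀ {l g} → InH g → inc g l ≡ true → Y l g ≡ true
            Y-intro {l} {g} θg g∈l = cong₂ _∧_ (dec-true (θ g ≟ₚ g) θg) g∈l

            Y-elim : ∀ {l g} → Y l g ≡ true → InH g × inc g l ≡ true
            Y-elim {l} {g} p = does⇒ (θ g ≟ₚ g) (Bool.∧-conicalˡ _ _ p) , Bool.∧-conicalʳ (isH g) _ p

          Y-subgroup : ∀ {l} → Stable l → inc ε l ≡ true → IsSubgroupOfH (Y l)
          Y-subgroup {l} stable ε∈l = record
            { ⊆H = λ g p → proj₁ (Y-elim {l} p)
            ; ε∈ = Y-intro H-ε ε∈l
            ; ∙∈ = λ x y p q → let θx , x∈l = Y-elim {l} p ; θy , y∈l = Y-elim {l} q in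
                   Y-intro (H-∙ θx θy) (subst (λ k → inc (x ∙ y) k ≡ true) (stable θy y∈l) (∙-on y x∈l))
            ; ⁻¹∈ = λ x p → let θx , x∈l = Y-elim {l} p in
                   Y-intro (H-⁻¹ θx) (subst (λ k → inc (x ⁻¹) k ≡ true) (·-swap x (stable θx x∈l)) (ε-on (x ⁻¹) ε∈l))
            }

          Y-size : ∀ l {k} → HasSize (Points₀ l) k → HasSize (Elems (Y (proj₁ l))) k
          Y-size (l , _) e = e ↔-∘ mk↔ₛ′ (λ (g , p) → (g , proj₁ (Y-elim {l} p)) , proj₂ (Y-elim {l} p))
            (λ ((g , θg) , g∈l) → g , Y-intro θg g∈l) (λ _ → Σ≡ (H≡ refl)) (λ _ → Σ≡ refl)

          Y-divides : ∀ {l k} → Stable l → inc ε l ≡ true → HasSize (Elems (Y l)) k → k ∣ suc s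
          Y-divides {l} stable ε∈l e = Cosets.coset-divides isGroup eG (Y l) ε∈ ∙∈ ⁻¹∈ (λ g → inc g l)
            (λ a y a∈l y∈Y → let θy , y∈l = Y-elim {l} y∈Y in subst (λ k → inc (a ∙ y) k ≡ true) (stable θy y∈l) (∙-on y a∈l))
            e (line-size l)
            where open IsSubgroupOfH (Y-subgroup {l} stable ε∈l)

          caseC : CaseC
          caseC = let a , e₁ = Points₀-size L₁ ; b , e₂ = Points₀-size L₂ in
            suc a , suc b , TwoLines.grid axioms₀ other-line (λ {x} {l} {m} {k} → two-lines {x} {l} {m} {k}) {εᴴ} L₁≢L₂ ε∈L₁ ε∈L₂ e₁ e₂ ,
            Y l₁ , Y l₂ , Y-subgroup stable₁ ε∈L₁ , Y-subgroup stable₂ ε∈L₂ , product ,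
            Y-size L₁ e₁ , Y-size L₂ e₂ , Y-divides stable₁ ε∈L₁ (Y-size L₁ e₁) , Y-divides stable₂ ε∈L₂ (Y-size L₂ e₂) ,
            (l₁ , λ g p → proj₂ (Y-elim {l₁} p)) , (l₂ , λ g p → proj₂ (Y-elim {l₂} p))
            where
            product : ∀ h → InH h → ∃[ y₁ ] ∃[ y₂ ] (Y l₁ y₁ ≡ true × Y l₂ y₂ ≡ true × h ≡ y₁ ∙ y₂)
            product h θh with factor θh
            ... | inj₁ h∈l₂ = ε , h , Y-intro H-ε ε∈L₁ , Y-intro θh h∈l₂ , sym (identityˡ h)
            ... | inj₂ (inj₁ (y , θy , y∈l₂ , l₂y≢l₂ , _)) = ⊥-elim (l₂y≢l₂ (stable₂ θy y∈l₂))
            ... | inj₂ (inj₂ (y , θy , y∈l₂ , p)) = h ∙ (y ⁻¹) , y , Y-intro (H-∙ θh (H-⁻¹ θy)) p , Y-intro θy y∈l₂ , sym (//-rightDividesˡ y h)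

        -- An element g₁ on l₁ that does not fix l₁ moves l₂ to l₁ and so interchanges the two classes of lines of the grid.
        module Swap {g₁ : G} (θg₁ : InH g₁) (g₁∈l₁ : inc g₁ l₁ ≡ true) (moved : l₁ · g₁ ≢ l₁) where
          l₂g₁≡l₁ : l₂ · g₁ ≡ l₁
          l₂g₁≡l₁ with lines-at θg₁ (proj₂ L₁) g₁∈l₁
          ... | inj₁ p = ⊥-elim (moved (sym p))
          ... | inj₂ p = sym p

          l₁g₁⁻¹≡l₂ : l₁ · (g₁ ⁻¹) ≡ l₂
          l₁g₁⁻¹≡l₂ = ·-swap g₁ l₂g₁≡l₁

          in-X₁? : ∀ g → Dec (InH g × l₁ · g ≡ l₁)
          in-X₁? g = (θ g ≟ₚ g) ×-dec (l₁ · g ≟ₗ l₁)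

          abstract
            X₁ : G → Bool
            X₁ g = does (in-X₁? g)

            X₁-intro : ∀ {g} → InH g → l₁ · g ≡ l₁ → X₁ g ≡ true
            X₁-intro {g} p q = dec-true (in-X₁? g) (p , q)

            X₁-elim : ∀ {g} → X₁ g ≡ true → InH g × l₁ · g ≡ l₁
            X₁-elim {g} = does⇒ (in-X₁? g)

          X₁-subgroup : IsSubgroupOfH X₁
          X₁-subgroup = record
            { ⊆H = λ g p → proj₁ (X₁-elim p)
            ; ε∈ = X₁-intro H-ε (·-ε l₁)
            ; ∙∈ = λ x y p q → let θx , x-fix = X₁-elim p ; θy , y-fix = X₁-elim q in
                   X₁-intro (H-∙ θx θy) (trans (sym (·-∙ l₁ x y)) (trans (cong (_· y) x-fix) y-fix))
            ; ⁻¹∈ = λ x p → let θx , x-fix = X₁-elim p in X₁-intro (H-⁻¹ θx) (·-swap x x-fix)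
            }

          X₁-on : ∀ {h} → X₁ h ≡ true → inc h l₁ ≡ true
          X₁-on {h} p = subst (λ k → inc h k ≡ true) (proj₂ (X₁-elim p)) (ε-on h ε∈L₁)

          g₁X₁-on : ∀ {x} → X₁ x ≡ true → inc (g₁ ∙ x) l₁ ≡ true
          g₁X₁-on {x} p = subst (λ k → inc (g₁ ∙ x) k ≡ true) (proj₂ (X₁-elim p)) (∙-on x g₁∈l₁)

          -- X₁ is the stabiliser of l₁ in H. A point h of l₁ outside it takes l₂ to l₁, while g₁⁻¹
          -- takes l₁ to l₂; hence g₁⁻¹ h is in X₁.
          on-l₁ : ∀ {h} → InH h → inc h l₁ ≡ true → X₁ h ≡ true ⊎ ∃[ x ] (X₁ x ≡ true × h ≡ g₁ ∙ x)
          on-l₁ {h} θh h∈l₁ with lines-at θh (proj₂ L₁) h∈l₁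
          ... | inj₁ p = inj₁ (X₁-intro θh (sym p))
          ... | inj₂ p = inj₂ ((g₁ ⁻¹) ∙ h , X₁-intro (H-∙ (H-⁻¹ θg₁) θh)
                  (trans (sym (·-∙ l₁ (g₁ ⁻¹) h)) (trans (cong (_· h) l₁g₁⁻¹≡l₂) (sym p))) , sym (\\-leftDividesˡ g₁ h))

          l₂-to-l₁ : ∀ h → inc h l₂ ≡ inc (h ∙ g₁) l₁
          l₂-to-l₁ h = trans (inc-∙ h l₂ g₁) (cong (inc (h ∙ g₁)) l₂g₁≡l₁)

          -- Right translation by g₁ maps l₂ to l₁, so the description of l₁ is carried over by
          -- multiplying with g₁⁻¹ on the right.
          on-l₂ : ∀ {h} → InH h → inc h l₂ ≡ true →
                  ∃[ x ] (X₁ x ≡ true × h ≡ (g₁ ∙ x) ∙ (g₁ ⁻¹)) ⊎ ∃[ x ] (X₁ x ≡ true × h ≡ x ∙ (g₁ ⁻¹))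
          on-l₂ {h} θh h∈l₂ = [ (λ p → inj₂ (h ∙ g₁ , p , sym (//-rightDividesʳ g₁ h))) ,
                                (λ (x , p , q) → inj₁ (x , p , trans (sym (//-rightDividesʳ g₁ h)) (cong (_∙ (g₁ ⁻¹)) q))) ]′
                              (on-l₁ {h ∙ g₁} (H-∙ θh θg₁) (trans (sym (l₂-to-l₁ h)) h∈l₂))

          l₂-on : ∀ {h z} → inc z l₁ ≡ true → h ≡ z ∙ (g₁ ⁻¹) → inc h l₂ ≡ true
          l₂-on {h} {z} p refl = trans (l₂-to-l₁ h) (trans (cong (λ w → inc w l₁) (//-rightDividesˡ g₁ z)) p)

          halves : (Elems X₁ ⊎ Elems X₁) ↔ Points₀ L₁
          halves = inj-surj⇒↔ half half-injective half-surjective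
            where
            half : Elems X₁ ⊎ Elems X₁ → Points₀ L₁
            half (inj₁ (x , p)) = (x , proj₁ (X₁-elim p)) , X₁-on p
            half (inj₂ (x , p)) = (g₁ ∙ x , H-∙ θg₁ (proj₁ (X₁-elim p))) , g₁X₁-on p
            -- If g₁ y is in the stabiliser for some y in it, then so is g₁, against `moved`.
            crossed : ∀ {x y} → X₁ x ≡ true → X₁ y ≡ true → x ≢ g₁ ∙ y
            crossed {x} {y} p q r = moved (·-injective y (trans (·-∙ l₁ g₁ y)
              (trans (cong (l₁ ·_) (sym r)) (trans (proj₂ (X₁-elim p)) (sym (proj₂ (X₁-elim q)))))))
            point : ∀ {c d} → half c ≡ half d → proj₁ (proj₁ (half c)) ≡ proj₁ (proj₁ (half d))
            point = cong (proj₁ ∘ proj₁)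
            half-injective : ∀ {c d} → half c ≡ half d → c ≡ d
            half-injective {inj₁ c} {inj₁ d} r = cong inj₁ (Σ≡ (point {inj₁ c} {inj₁ d} r))
            half-injective {inj₂ c} {inj₂ d} r = cong inj₂ (Σ≡ (∙-cancelˡ g₁ (proj₁ c) (proj₁ d) (point {inj₂ c} {inj₂ d} r)))
            half-injective {inj₁ c} {inj₂ d} r = ⊥-elim (crossed (proj₂ c) (proj₂ d) (point {inj₁ c} {inj₂ d} r))
            half-injective {inj₂ c} {inj₁ d} r = ⊥-elim (crossed (proj₂ d) (proj₂ c) (sym (point {inj₂ c} {inj₁ d} r)))
            half-surjective : ∀ x → ∃[ c ] half c ≡ x
            half-surjective ((h , θh) , h∈l₁) with on-l₁ θh h∈l₁
            ... | inj₁ p = inj₁ (h , p) , Σ≡ (H≡ refl)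
            ... | inj₂ (x , p , q) = inj₂ (x , p) , Σ≡ (H≡ (sym q))

          generates-l₁ : ∀ {h} → InH h → inc h l₁ ≡ true → Gen X₁ g₁ h
          generates-l₁ θh h∈l₁ = [ gen-X _ , (λ { (x , p , refl) → gen-∙ gen-g (gen-X x p) }) ]′ (on-l₁ θh h∈l₁)

          generates-l₂ : ∀ {h} → InH h → inc h l₂ ≡ true → Gen X₁ g₁ h
          generates-l₂ θh h∈l₂ = [ (λ { (x , p , refl) → gen-∙ (gen-∙ gen-g (gen-X x p)) (gen-⁻¹ gen-g) }) ,
                                   (λ { (x , p , refl) → gen-∙ (gen-X x p) (gen-⁻¹ gen-g) }) ]′ (on-l₂ θh h∈l₂)

          generates : ∀ {h} → InH h → Gen X₁ g₁ h
          generates {h} θh with factor θh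
          ... | inj₁ h∈l₂ = generates-l₂ θh h∈l₂
          ... | inj₂ (inj₁ (y , θy , y∈l₂ , _ , p)) =
            subst (Gen X₁ g₁) (//-rightDividesˡ y h) (gen-∙ (generates-l₂ (H-∙ θh (H-⁻¹ θy)) p) (generates-l₂ θy y∈l₂))
          ... | inj₂ (inj₂ (y , θy , y∈l₂ , p)) =
            subst (Gen X₁ g₁) (//-rightDividesˡ y h) (gen-∙ (generates-l₁ (H-∙ θh (H-⁻¹ θy)) p) (generates-l₂ θy y∈l₂))

          generated-in-H : ∀ {h} → Gen X₁ g₁ h → InH h
          generated-in-H (gen-X x p) = proj₁ (X₁-elim p)
          generated-in-H gen-g       = θg₁
          generated-in-H gen-ε       = H-ε
          generated-in-H (gen-∙ c d) = H-∙ (generated-in-H c) (generated-in-H d)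
          generated-in-H (gen-⁻¹ c)  = H-⁻¹ (generated-in-H c)

          -- Every fixed line is a translate of l₁ or of l₂, and g₁ takes l₂ to l₁; so H is
          -- transitive on the fixed lines.
          line-size₀ : ∀ {k} → HasSize (Points₀ L₁) k → ∀ m → HasSize (Points₀ m) k
          line-size₀ {k} e₁ m with point-on m
          ... | h , h∈m with lines-at (proj₂ h) (proj₂ m) h∈m
          ... | inj₁ p = subst (λ l → HasSize (Points₀ l) k) (L₀≡ {L₁ ·ᴴ h} {m} (sym p)) (e₁ ↔-∘ Points₀-· L₁ h)
          ... | inj₂ p = subst (λ l → HasSize (Points₀ l) k) (L₀≡ {L₂ ·ᴴ h} {m} (sym p)) (e₂ ↔-∘ Points₀-· L₂ h)
            where
            e₂ : HasSize (Points₀ L₂) k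
            e₂ = subst (λ l → HasSize (Points₀ l) k) (L₀≡ {L₁} {L₂ ·ᴴ (g₁ , θg₁)} (sym l₂g₁≡l₁)) e₁
                 ↔-∘ ↔-sym (Points₀-· L₂ (g₁ , θg₁))

          caseC' : CaseC'
          caseC' = suc a , sub-GQ (line-size₀ e₁) point-size₀ , ℕ.⊓-glb (sub-s≤s L₁ e₁) s₁≤t , X₁ , g₁ , X₁-subgroup , θg₁ ,
            (k , eX , trans (cong (k ℕ.+_) (ℕ.+-identityʳ k)) (size-unique (size-⊎ eX eX) (e₁ ↔-∘ halves))) ,
            (λ h → mk⇔ generates generated-in-H) ,
            l₁ , l₂ , proj₂ L₁ , proj₂ L₂ , l₁≢l₂ , ε∈L₁ , ε∈L₂ ,
            (λ h θh → mk⇔ (on-l₁ θh) [ X₁-on , (λ { (x , p , refl) → g₁X₁-on p }) ]′) ,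
            (λ h θh → mk⇔ (on-l₂ θh) [ (λ (x , p , q) → l₂-on (g₁X₁-on p) q) , (λ (x , p , q) → l₂-on (X₁-on p) q) ]′)
            where
            a = proj₁ (Points₀-size L₁)
            e₁ = proj₂ (Points₀-size L₁)
            k = proj₁ (subset-size {f = X₁} {g = λ _ → true} eG Bool._≟_)
            eX = proj₂ (subset-size {f = X₁} {g = λ _ → true} eG Bool._≟_)
            s₁≤t : suc a ℕ.≤ t
            -- The dual inequality with one less than two lines per point, t₁ = 1; its hypothesis 1
            -- < t is thickness.
            s₁≤t = subst (ℕ._≤ t) (ℕ.*-identityˡ (suc a)) (sub-bound-dual (line-size₀ e₁) point-size₀ 2≤t)

        caseC⊎C' : CaseC ⊎ CaseC'
        caseC⊎C' with forall? eH (λ x → (inc₀ x L₁ Bool.≟ true) →-dec (l₁ · proj₁ x ≟ₗ l₁))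
        ... | yes stable = inj₁ (caseC (λ {h} θh → stable (h , θh)))
        ... | no ¬stable with counterexample eH (λ x → (inc₀ x L₁ Bool.≟ true) →-dec (l₁ · proj₁ x ≟ₗ l₁)) ¬stable
        ... | (g₁ , θg₁) , ¬p with inc g₁ l₁ Bool.≟ true
        ... | yes g₁∈l₁ = inj₂ (Swap.caseC' θg₁ g₁∈l₁ (λ q → ¬p (λ _ → q)))
        ... | no g₁∉l₁  = ⊥-elim (¬p (λ g₁∈l₁ → ⊥-elim (g₁∉l₁ g₁∈l₁)))

    two-fixed-lines : HasSize (Lines₀ εᴴ) 2 → CaseC ⊎ CaseC'
    two-fixed-lines e = let (_ , p) , (_ , q) , p≢q = two-elements e in
      TwoFixedLines.caseC⊎C' e (λ r → p≢q (Σ≡ r)) p q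

    nondegenerate : CaseC ⊎ CaseC' ⊎ CaseD ⊎ CaseE
    nondegenerate with line-through εᴴ
    ... | l , p with other-line εᴴ l
    ... | m , m≢l , q with at-least-two {a = m , q} {l , p} (λ r → m≢l (cong proj₁ r)) e
      where e = proj₂ (subset-size {f = inc₀ εᴴ} {g = λ _ → true} eL₀ Bool._≟_)
    ... | zero  , k≡ = Sum.map₂ inj₁ (two-fixed-lines (subst (HasSize (Lines₀ εᴴ)) k≡ (proj₂ (subset-size {f = inc₀ εᴴ} {g = λ _ → true} eL₀ Bool._≟_))))
    ... | suc k , k≡ = inj₂ (inj₂ (many-lines (subst (HasSize (Lines₀ εᴴ)) k≡ (proj₂ (subset-size {f = inc₀ εᴴ} {g = λ _ → true} eL₀ Bool._≟_)))))

  -- Assembling the cases.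

  -- A line containing all of H has two fixed points on it and is therefore fixed. Testing (b) first
  -- thus leaves the existence of a fixed line to separate (a) from the remaining cases.
  classify : ∀ {h} → InH h → h ≢ ε → CaseA ⊎ CaseB ⊎ CaseC ⊎ CaseC' ⊎ CaseD ⊎ CaseE
  classify θh h≢ε with search eL (λ l → forall? eH (λ x → inc (proj₁ x) l Bool.≟ true))
  ... | yes common = inj₂ (inj₁ (caseB θh h≢ε common))
  ... | no spread with search eL (λ l → φ l ≟ₗ l)
  ... | no none  = inj₁ (caseA (λ l φl → none (l , φl)))
  ... | yes l*   = inj₂ (inj₂ (Nondegenerate.nondegenerate spread l*))

  conclusion : Conclusion
  conclusion with forall? eH (λ x → proj₁ x ≟ₚ ε)
  ... | yes trivial = inj₁ (λ g θg → trivial (g , θg))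
  ... | no nontrivial with counterexample eH (λ x → proj₁ x ≟ₚ ε) nontrivial
  ... | (h , θh) , h≢ε with at-least-two {a = h , θh} {εᴴ} (λ p → h≢ε (cong proj₁ p)) eH
  ... | j , n≡ = inj₂ (n , (eH , subst (1 ℕ.<_) (sym n≡) (ℕ.s≤s (ℕ.s≤s ℕ.z≤n))) , classify θh h≢ε)

open import Data.Nat using (_≤_)

theorem3p3 : (G : Set) (_∙_ : G → G → G) (ε : G) (_⁻¹ : G → G) →
    IsGroup _≡_ _∙_ ε _⁻¹ →
    (nG : ℕ) → HasSize G nG →
    (L : Set) (nL : ℕ) → HasSize L nL →
    (inc : G → L → Bool) (s t : ℕ) →
    2 ≤ s → 2 ≤ t →
    IsGQ (mkInc G L inc) s t →
    (∀ h → Σ (L → L) (λ ψ → IsAut inc (λ x → x ∙ h) ψ)) →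
    (θ : G → G) → IsGroupAutomorphism G _∙_ ε _⁻¹ θ →
    (φ : L → L) → IsAut inc θ φ →
    Setting.Conclusion G _∙_ ε _⁻¹ L inc s t θ φ
theorem3p3 = Multiplier.conclusion
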